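{- For every fixed integer $t\ge 2$, $\mathrm{Ex}(P_t,n)=\Theta\big(n(\log n/\log\log n)^t\big)$ as $n\to\infty$ (the implied constants may depend on $t$).
   Context: A pattern is a 0--1 matrix. A 0--1 matrix $A$ contains a pattern $P$ if $A$ can be transformed into $P$ by removing rows and columns from $A$ (keeping the order of the remaining ones) and changing some 1s to 0s; otherwise $A$ is $P$-free. $\mathrm{Ex}(P,n)$ is the maximum number of 1s in an $n\times n$ 0--1 matrix that is $P$-free. $\log$ is the binary logarithm. The alternating pattern $P_t$ is the $2\times(t+2)$ 0--1 matrix with rows indexed $0,1$ (top to bottom) and columns indexed $0,1,\dots,t+1$ (left to right), whose column $0$ has 1s in both rows, and whose column $j$, for $1\le j\le t+1$, has exactly one 1, located in row $0$ if $j$ is odd and in row $1$ if $j$ is even. For example $P_1=\begin{pmatrix}1&1&0\\1&0&1\end{pmatrix}$. -}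

module Defs where

open import Algebra.Bundles using (CommutativeRing)
open import Data.Bool.Base using (Bool; true; false; if_then_else_)
import Data.Bool.Properties as Bool
open import Data.Fin.Base as Fin using (Fin; zero; suc; toℕ; finToFun; funToFin)
open import Data.Fin.Patterns using (0F; 1F)
import Data.Fin.Properties as Fin
open import Data.Integer.Base as ℤ using (ℤ; +_; -[1+_])
open import Data.List.Base using (List; map; filter; allFin)
open import Data.List.Membership.Propositional using (_∈_; lose)
open import Data.List.Membership.Propositional.Properties
  using (∈-map⁺; ∈-map⁻; ∈-filter⁺; ∈-filter⁻; ∈-allFin)
open import Data.Nat.Base as ℕ using (ℕ; zero; suc)
import Data.Nat.Properties as ℕ
open import Data.Product.Base using (Σ-syntax; ∃; ∃₂; ∃-syntax; _×_; _,_; proj₁; proj₂)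
open import Data.Rational.Base as ℚ using (ℚ; 0ℚ; 1ℚ; ½; ↥_; ↧ₙ_)
import Data.Rational.Properties as ℚ
open import Data.Sum.Base using (inj₁; inj₂)
open import Function.Base using (_∘_)
open import Function.Bundles using (Inverse)
open import Relation.Binary.Core using (_Preserves_⟶_)
open import Relation.Binary.PropositionalEquality
  using (_≡_; refl; sym; trans; cong; subst; subst₂)
open import Relation.Nullary.Decidable
  using (Dec; ⌊_⌋; map′; ¬?; _×-dec_; _→-dec_)
open import Relation.Nullary.Negation using (¬_)

open import Algebra.Properties.Monoid.Sum ℕ.+-0-monoid using (sum; sum-cong-≗)
open import Algebra.Properties.Semiring.Exp (CommutativeRing.semiring ℚ.+-*-commutativeRing)
  using () renaming (_^_ to _^ℚ_)
open import Data.List.Extrema ℕ.≤-totalOrder using (max; v≤max⁺; argmax-sel)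

------------------------------------------------------------------------
-- 0–1 matrices and patterns

Matrix : ℕ → ℕ → Set
Matrix m n = Fin m → Fin n → Bool

ones : ∀ {m n} → Matrix m n → ℕ
ones A = sum (λ i → sum (λ j → if A i j then 1 else 0))

StrictlyIncreasing : ∀ {k m} → (Fin k → Fin m) → Set
StrictlyIncreasing f = f Preserves Fin._<_ ⟶ Fin._<_

-- The rows and columns that are kept are the images of ρ and γ; every 1 of P
-- must already be a 1 there, while a 0 of P may come from either entry.
_Contains_ : ∀ {m n k l} → Matrix m n → Matrix k l → Set
_Contains_ {m} {n} {k} {l} A P =
  Σ[ ρ ∈ (Fin k → Fin m) ] Σ[ γ ∈ (Fin l → Fin n) ]
    StrictlyIncreasing ρ × StrictlyIncreasing γ ×
    (∀ i j → P i j ≡ true → A (ρ i) (γ j) ≡ true)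

_Avoids_ : ∀ {m n k l} → Matrix m n → Matrix k l → Set
A Avoids P = ¬ (A Contains P)

-- Row 0 is the top row.
alternating : ∀ t → Matrix 2 (t ℕ.+ 2)
alternating t i j with toℕ j
alternating t i  j | zero      = true
alternating t 0F j | c@(suc _) = ⌊ c ℕ.% 2 ℕ.≟ 1 ⌋
alternating t 1F j | c@(suc _) = ⌊ c ℕ.% 2 ℕ.≟ 0 ⌋

------------------------------------------------------------------------
-- The extremal function

private

  decode : ∀ {m n} → Fin ((2 ℕ.^ n) ℕ.^ m) → Matrix m n
  decode c i j = Inverse.to Fin.2↔Bool (finToFun (finToFun c i) j)

  encode : ∀ {m n} → Matrix m n → Fin ((2 ℕ.^ n) ℕ.^ m)
  encode A = funToFin (λ i → funToFin (Inverse.from Fin.2↔Bool ∘ A i))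

  decode-encode : ∀ {m n} (A : Matrix m n) i j → decode (encode A) i j ≡ A i j
  decode-encode A i j = trans
    (cong (λ r → Inverse.to Fin.2↔Bool (finToFun r j))
      (Fin.finToFun-funToFin (λ i → funToFin (Inverse.from Fin.2↔Bool ∘ A i)) i))
    (trans (cong (Inverse.to Fin.2↔Bool)
             (Fin.finToFun-funToFin (Inverse.from Fin.2↔Bool ∘ A i) j))
           (Inverse.inverseˡ Fin.2↔Bool refl))

  anyFun? : ∀ {k m} {Q : (Fin k → Fin m) → Set} →
            (∀ {f g} → (∀ i → f i ≡ g i) → Q f → Q g) →
            (∀ f → Dec (Q f)) → Dec (∃ Q)
  anyFun? resp Q? = map′
    (λ (c , q) → finToFun c , q)
    (λ (f , q) → funToFin f , resp (λ i → sym (Fin.finToFun-funToFin f i)) q)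
    (Fin.any? (λ c → Q? (finToFun c)))

  increasing? : ∀ {k m} (f : Fin k → Fin m) → Dec (StrictlyIncreasing f)
  increasing? f = map′ (λ h {i} {j} → h i j) (λ h i j → h {i} {j})
    (Fin.all? λ i → Fin.all? λ j → (i Fin.<? j) →-dec (f i Fin.<? f j))

  increasing-resp : ∀ {k m} {f g : Fin k → Fin m} → (∀ i → f i ≡ g i) →
                    StrictlyIncreasing f → StrictlyIncreasing g
  increasing-resp e inc i<j = subst₂ Fin._<_ (e _) (e _) (inc i<j)

contains? : ∀ {m n k l} (A : Matrix m n) (P : Matrix k l) → Dec (A Contains P)
contains? A P =
  anyFun? (λ e (γ , incρ , incγ , h) →
             γ , increasing-resp e incρ , incγ ,
             λ i j p → subst (λ r → A r (γ j) ≡ true) (e i) (h i j p)) λ ρ →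
  anyFun? (λ e (incρ , incγ , h) →
             incρ , increasing-resp e incγ ,
             λ i j p → subst (λ c → A (ρ i) c ≡ true) (e j) (h i j p)) λ γ →
  increasing? ρ ×-dec increasing? γ ×-dec
  (Fin.all? λ i → Fin.all? λ j →
     (P i j Bool.≟ true) →-dec (A (ρ i) (γ j) Bool.≟ true))

avoiders : ∀ {k l} → Matrix k l → (n : ℕ) → List (Matrix n n)
avoiders P n = filter (λ A → ¬? (contains? A P)) (map decode (allFin _))

-- The value is 0 when no n × n matrix avoids P, which can only happen if P has no 1s.
Ex : ∀ {k l} → Matrix k l → ℕ → ℕ
Ex P n = max 0 (map ones (avoiders P n))

-- Since matrices are functions, the enumeration is complete only up to
-- pointwise equality; the next two lemmas confirm that Ex is the maximum.

ones≤Ex : ∀ {k l} (P : Matrix k l) {n} (A : Matrix n n) →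
          A Avoids P → ones A ℕ.≤ Ex P n
ones≤Ex P {n} A free = v≤max⁺ 0 (map ones (avoiders P n))
  (inj₂ (lose (∈-map⁺ ones A′∈) (ℕ.≤-reflexive (sym ones≡))))
  where
  A′ : Matrix n n
  A′ = decode (encode A)

  ones≡ : ones A′ ≡ ones A
  ones≡ = sum-cong-≗ λ i → sum-cong-≗ λ j →
    cong (if_then 1 else 0) (decode-encode A i j)

  A′∈ : A′ ∈ avoiders P n
  A′∈ = ∈-filter⁺ (λ B → ¬? (contains? B P)) (∈-map⁺ decode (∈-allFin (encode A)))
    λ (ρ , γ , incρ , incγ , h) → free (ρ , γ , incρ , incγ ,
      λ i j p → trans (sym (decode-encode A (ρ i) (γ j))) (h i j p))

Ex-attained : ∀ {k l} (P : Matrix k l) {n} → (∃[ A ] A Avoids P) →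
              Σ[ A ∈ Matrix n n ] A Avoids P × ones A ≡ Ex P n
Ex-attained P {n} (A , free)
  with argmax-sel (λ x → x) 0 (map ones (avoiders P n))
... | inj₁ Ex≡0 = A , free ,
  ℕ.≤-antisym (ones≤Ex P A free) (subst (ℕ._≤ ones A) (sym Ex≡0) ℕ.z≤n)
... | inj₂ Ex∈ with ∈-map⁻ ones Ex∈
... | B , B∈ , Ex≡ = B , proj₂ (∈-filter⁻ (λ C → ¬? (contains? C P)) {xs = map decode (allFin _)} B∈) , sym Ex≡

------------------------------------------------------------------------
-- Real numbers as Dedekind cuts

-- A real number x is given by the sets of rationals q < x (Lower) and q > x
-- (Upper).  The cut axioms are not part of the record, so that the operations
-- below are total; each yields the cut of the intended real number on the
-- domain stated with it.
record ℝ : Set₁ where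
  field
    Lower : ℚ → Set
    Upper : ℚ → Set

open ℝ public

infix  4 _≤ᴿ_
infixl 7 _*ᴿ_ _÷ᴿ_
infixr 8 _^ᴿ_

_≤ᴿ_ : ℝ → ℝ → Set
x ≤ᴿ y = ∀ q → Lower x q → Lower y q

fromℚ : ℚ → ℝ
fromℚ p .Lower q = q ℚ.< p
fromℚ p .Upper q = p ℚ.< q

fromℕ : ℕ → ℝ
fromℕ n = fromℚ (+ n ℚ./ 1)

-- For x, y > 0.
_*ᴿ_ : ℝ → ℝ → ℝ
(x *ᴿ y) .Lower q = ∃₂ λ a b → 0ℚ ℚ.< a × Lower x a × 0ℚ ℚ.< b × Lower y b × q ℚ.≤ a ℚ.* b
(x *ᴿ y) .Upper q = ∃₂ λ a b → Upper x a × Upper y b × a ℚ.* b ℚ.≤ q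

-- For x, y > 0.
_÷ᴿ_ : ℝ → ℝ → ℝ
(x ÷ᴿ y) .Lower q = ∃₂ λ a b → Lower x a × Upper y b × q ℚ.* b ℚ.≤ a
(x ÷ᴿ y) .Upper q = ∃₂ λ a b → Upper x a × 0ℚ ℚ.< b × Lower y b × a ℚ.≤ q ℚ.* b

-- For x > 0.
_^ᴿ_ : ℝ → ℕ → ℝ
x ^ᴿ zero  = fromℚ 1ℚ
x ^ᴿ suc k = x *ᴿ x ^ᴿ k

exp₂ : ℤ → ℚ
exp₂ (+ n)    = (1ℚ ℚ.+ 1ℚ) ^ℚ n
exp₂ -[1+ n ] = ½ ^ℚ suc n

-- For x > 0.  With q = p / d in lowest terms, q < log₂ x iff 2ᵖ < xᵈ, that is,
-- iff 2ᵖ ≤ aᵈ for some positive rational a < x; similarly for q > log₂ x.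
log₂ : ℝ → ℝ
log₂ x .Lower q = ∃ λ a → 0ℚ ℚ.< a × Lower x a × exp₂ (↥ q) ℚ.≤ a ^ℚ (↧ₙ q)
log₂ x .Upper q = ∃ λ a → Upper x a × a ^ℚ (↧ₙ q) ℚ.≤ exp₂ (↥ q)

-- f(n) = Θ(g(n)) as n → ∞, for eventually positive g.  Rational constants lose
-- nothing, as every positive real has positive rationals below and above it.
_=Θ_ : (ℕ → ℝ) → (ℕ → ℝ) → Set
f =Θ g =
  ∃₂ λ (c C : ℚ) → 0ℚ ℚ.< c × 0ℚ ℚ.< C ×
  (∃ λ (N : ℕ) → ∀ n → N ℕ.≤ n →
    (fromℚ c *ᴿ g n ≤ᴿ f n) × (f n ≤ᴿ fromℚ C *ᴿ g n))

{-# OPTIONS --safe #-}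

-- Upper bound.  Divide the distances up to n into cells of relative length 1/B, where B is a
-- small power of log n, and look at the cells that the 1s to the right of a given 1 occupy.
-- A row has only O((log n / log B)^t) 1s with at most t occupied cells: grouping them by the
-- power of B next to their distance from the last 1 of the row, that last 1 takes up a cell of
-- its own, and one recurses on t.  For the other 1s fix t + 1 occupied cells.  Two 1s of a column
-- with the same cells in all even places (counting from 1) yield P_t, the upper row using its
-- cells in odd places, the lower row those in even places.  Already sharing all but the first and
-- the third cell is enough, so a column has at most (B log n)^(t-1) of these 1s.
--
-- Lower bound.  Scales are powers of Q, a power of m ≈ log n / log log n.  A column of a row is
-- reached by a jump in one of m scales in each of t coordinates.  The scales of the first t - 1
-- jumps are recorded in the column, the sizes of the jumps depend monotonically on a label h
-- of the row, alternately increasing and decreasing from coordinate to coordinate, and the label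
-- grows along the jumps so that no two rows of a column have the same h.  In a copy of P_t every
-- coordinate then forces all but the last of the remaining columns into the scale of column 0,
-- until two columns remain, whose order contradicts that of the labels.
module Submission where

open import Defs

module Combinatorics where

  open import Data.Bool.Base using (Bool; true; false; if_then_else_; _∧_)
  import Data.Bool.Properties as Bool
  open import Data.Fin.Base as Fin
    using (Fin; zero; suc; toℕ; fromℕ<; funToFin; finToFun; combine; remQuot; inject≤; opposite)
  open import Data.Fin.Patterns using (0F; 1F)
  import Data.Fin.Properties as Fin
  open import Data.Nat.Base
  open import Data.Nat.DivMod
  open import Data.Nat.Properties
  open import Data.Nat.Tactic.RingSolver using (solve-∀)
  open import Data.Product.Base
  open import Data.Sum.Base using (_⊎_; inj₁; inj₂)
  open import Function.Base using (_∘_)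
  open import Relation.Binary.Definitions using (tri<; tri≈; tri>)
  open import Relation.Binary.PropositionalEquality
  open import Relation.Nullary

  open import Algebra.Properties.CommutativeMonoid.Sum +-0-commutativeMonoid
    using (sum; ∑-comm; ∑-distrib-+)

  -- Finite sums and counting

  ⟦_⟧ : Bool → ℕ
  ⟦ b ⟧ = if b then 1 else 0

  count : ∀ {n} → (Fin n → Bool) → ℕ
  count f = sum (λ i → ⟦ f i ⟧)

  sum-mono-≤ : ∀ {n} {f g : Fin n → ℕ} → (∀ i → f i ≤ g i) → sum f ≤ sum g
  sum-mono-≤ {zero}  f≤g = z≤n
  sum-mono-≤ {suc n} f≤g = +-mono-≤ (f≤g zero) (sum-mono-≤ (f≤g ∘ suc))

  sum-const : ∀ n c → sum {n} (λ _ → c) ≡ n * c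
  sum-const zero    c = refl
  sum-const (suc n) c = cong (c +_) (sum-const n c)

  term≤sum : ∀ {n} (f : Fin n → ℕ) i → f i ≤ sum f
  term≤sum f zero    = m≤m+n (f zero) _
  term≤sum f (suc i) = ≤-trans (term≤sum (f ∘ suc) i) (m≤n+m _ (f zero))

  ⟦⌊⌋⟧-yes : ∀ {a} {P : Set a} (P? : Dec P) → P → ⟦ ⌊ P? ⌋ ⟧ ≡ 1
  ⟦⌊⌋⟧-yes (yes _) p = refl
  ⟦⌊⌋⟧-yes (no ¬p) p = contradiction p ¬p

  ⌊⌋≡true : ∀ {a} {P : Set a} (P? : Dec P) → P → ⌊ P? ⌋ ≡ true
  ⌊⌋≡true (yes _) p = refl
  ⌊⌋≡true (no ¬p) p = contradiction p ¬p

  witness : ∀ {a} {P : Set a} (P? : Dec P) → ⌊ P? ⌋ ≡ true → P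
  witness (yes p) _ = p

  ∧-elim : ∀ {a b} → a ∧ b ≡ true → a ≡ true × b ≡ true
  ∧-elim {true} {true} _ = refl , refl

  ∧-intro : ∀ {a b} → a ≡ true → b ≡ true → a ∧ b ≡ true
  ∧-intro refl refl = refl

  ⟦⟧-bound : ∀ {b k} → (b ≡ true → 1 ≤ k) → ⟦ b ⟧ ≤ k
  ⟦⟧-bound {true}  h = h refl
  ⟦⟧-bound {false} h = z≤n

  -- Strict monotonicity serves twice: it gives the injectivity behind `count≤`, and it lists the
  -- occupied cells of a 1 in order of distance.
  enumerate : ∀ {n} (f : Fin n → Bool) s → s ≤ count f →
              Σ[ k ∈ (Fin s → Fin n) ] StrictlyIncreasing k × (∀ p → f (k p) ≡ true)
  enumerate f zero le = (λ ()) , (λ {}) , λ ()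
  enumerate {suc n} f (suc s) le with f zero in eq
  ... | false with k , inc , h ← enumerate (f ∘ suc) (suc s) le =
    suc ∘ k , (λ i<j → s≤s (inc i<j)) , h
  ... | true with k , inc , h ← enumerate (f ∘ suc) s (s≤s⁻¹ le) =
    (λ { zero → zero ; (suc p) → suc (k p) }) ,
    (λ { {zero} {suc j} _ → z<s ; {suc i} {suc j} i<j → s≤s (inc (s≤s⁻¹ i<j)) }) ,
    λ { zero → eq ; (suc p) → h p }

  StrictlyIncreasing⇒injective : ∀ {s n} {k : Fin s → Fin n} → StrictlyIncreasing k →
                                 ∀ {i j} → k i ≡ k j → i ≡ j
  StrictlyIncreasing⇒injective inc {i} {j} eq with Fin.<-cmp i j
  ... | tri< i<j _ _ = contradiction eq (Fin.<⇒≢ (inc i<j))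
  ... | tri≈ _ i≡j _ = i≡j
  ... | tri> _ _ j<i = contradiction (sym eq) (Fin.<⇒≢ (inc j<i))

  -- Pigeonhole principle. `τ` takes the proof of `f i ≡ true`, because the code of a 1 in
  -- `rich-count` is built from the proof that it is rich.
  count≤ : ∀ {n m} (f : Fin n → Bool) (τ : ∀ {i} → f i ≡ true → Fin m) →
           (∀ {i j} (p : f i ≡ true) (q : f j ≡ true) → τ p ≡ τ q → i ≡ j) → count f ≤ m
  count≤ f τ inj with k , inc , h ← enumerate f (count f) ≤-refl =
    Fin.injective⇒≤ {f = λ p → τ (h p)} λ {p} {q} eq →
      StrictlyIncreasing⇒injective inc (inj (h p) (h q) eq)

  count-mono-< : ∀ {n} {f g : Fin n → Bool} → (∀ i → f i ≡ true → g i ≡ true) →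
                 ∀ i → f i ≡ false → g i ≡ true → count f < count g
  count-mono-< {suc n} {f} {g} h zero fi gi rewrite fi | gi =
    s≤s (sum-mono-≤ λ j → ⟦⟧-bound λ e → ≤-reflexive (cong ⟦_⟧ (sym (h (suc j) e))))
  count-mono-< {suc n} {f} {g} h (suc i) fi gi =
    +-mono-≤-< (⟦⟧-bound λ e → ≤-reflexive (cong ⟦_⟧ (sym (h zero e))))
      (count-mono-< (h ∘ suc) i fi gi)

  -- Double counting over the graph of `e`: every `p` hits one index, and by injectivity every index
  -- is hit at most once.
  sum-subset : ∀ {n m} (g : Fin n → ℕ) (e : Fin m → Fin n) →
               (∀ {p q} → e p ≡ e q → p ≡ q) → sum (g ∘ e) ≤ sum g
  sum-subset {n} {m} g e inj = begin
    sum (g ∘ e)                                            ≤⟨ sum-mono-≤ own ⟩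
    sum (λ p → sum (λ i → ⟦ ⌊ e p Fin.≟ i ⌋ ⟧ * g i))      ≡⟨ ∑-comm (λ p i → ⟦ ⌊ e p Fin.≟ i ⌋ ⟧ * g i) ⟩
    sum (λ i → sum (λ p → ⟦ ⌊ e p Fin.≟ i ⌋ ⟧ * g i))      ≤⟨ sum-mono-≤ once ⟩
    sum g                                                  ∎
    where
    open ≤-Reasoning
    own : ∀ p → g (e p) ≤ sum (λ i → ⟦ ⌊ e p Fin.≟ i ⌋ ⟧ * g i)
    own p = begin
      g (e p)                               ≡⟨ *-identityˡ _ ⟨
      1 * g (e p)                           ≡⟨ cong (_* g (e p)) (⟦⌊⌋⟧-yes (e p Fin.≟ e p) refl) ⟨
      ⟦ ⌊ e p Fin.≟ e p ⌋ ⟧ * g (e p)       ≤⟨ term≤sum (λ i → ⟦ ⌊ e p Fin.≟ i ⌋ ⟧ * g i) (e p) ⟩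
      sum (λ i → ⟦ ⌊ e p Fin.≟ i ⌋ ⟧ * g i) ∎
    sum-*ʳ : ∀ {k} (f : Fin k → ℕ) c → sum (λ p → f p * c) ≡ sum f * c
    sum-*ʳ {zero}  f c = refl
    sum-*ʳ {suc k} f c = trans (cong (f zero * c +_) (sum-*ʳ (f ∘ suc) c)) (sym (*-distribʳ-+ c (f zero) _))
    once : ∀ i → sum (λ p → ⟦ ⌊ e p Fin.≟ i ⌋ ⟧ * g i) ≤ g i
    once i = begin
      sum (λ p → ⟦ ⌊ e p Fin.≟ i ⌋ ⟧ * g i)    ≡⟨ sum-*ʳ (λ p → ⟦ ⌊ e p Fin.≟ i ⌋ ⟧) (g i) ⟩
      count (λ p → ⌊ e p Fin.≟ i ⌋) * g i      ≤⟨ *-monoˡ-≤ (g i) (count≤ (λ p → ⌊ e p Fin.≟ i ⌋) (λ _ → zero {0})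
        (λ {p} {q} ep eq _ → inj (trans (witness (e p Fin.≟ i) ep) (sym (witness (e q Fin.≟ i) eq))))) ⟩
      1 * g i                                  ≡⟨ *-identityˡ _ ⟩
      g i                                      ∎

  -- The upper bound

  -- Finds where `f` crosses the level `d`. It serves for the cells, for the powers of `B` and, in
  -- `log-bracket`, for rounded-down logarithms.
  bracket : ∀ (f : ℕ → ℕ) L {d} → f 0 ≤ d → d < f L →
            Σ[ k ∈ Fin L ] f (toℕ k) ≤ d × d < f (suc (toℕ k))
  bracket f zero    f0≤d d<fL = contradiction d<fL (≤⇒≯ f0≤d)
  bracket f (suc L) {d} f0≤d d<fL with d <? f 1
  ... | yes d<f1 = zero , f0≤d , d<f1
  ... | no  d≮f1 with k , lo , hi ← bracket (f ∘ suc) L (≮⇒≥ d≮f1) d<fL = suc k , lo , hi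

  last-true : ∀ {n} (S : Fin n → Bool) → (∀ c → S c ≡ false) ⊎
              Σ[ e ∈ Fin n ] S e ≡ true × (∀ c → S c ≡ true → c Fin.≤ e)
  last-true {zero}  S = inj₁ λ ()
  last-true {suc n} S with last-true (S ∘ suc)
  ... | inj₂ (e , Se , max) = inj₂ (suc e , Se , λ { zero _ → z≤n ; (suc c) Sc → s≤s (max c Sc) })
  ... | inj₁ none with S zero in eq
  ...   | true  = inj₂ (zero , eq , λ { zero _ → z≤n ; (suc c) Sc → contradiction (trans (sym (none c)) Sc) λ () })
  ...   | false = inj₁ λ { zero → eq ; (suc c) → none c }

  -- Cells of distances, and elements with few occupied cells

  module _ (B : ℕ) .{{_ : NonZero B}} where

    -- Cell k consists of the distances from u k up to u (k+1); its relative
    -- length is about 1/B.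
    u : ℕ → ℕ
    u zero    = 1
    u (suc k) = suc (u k + u k / B)

    u-mono-suc : ∀ k → u k < u (suc k)
    u-mono-suc k = s≤s (m≤m+n (u k) _)

    u-mono-≤ : ∀ {k l} → k ≤ l → u k ≤ u l
    u-mono-≤ {k} k≤l = subst (λ x → u k ≤ u x) (m+[n∸m]≡n k≤l) (go (_ ∸ k))
      where
      go : ∀ j → u k ≤ u (k + j)
      go zero = ≤-reflexive (cong u (sym (+-identityʳ k)))
      go (suc j) = ≤-trans (go j) (≤-trans (<⇒≤ (u-mono-suc (k + j))) (≤-reflexive (cong u (sym (+-suc k j)))))

    1≤u : ∀ k → 1 ≤ u k
    1≤u k = u-mono-≤ {0} z≤n

    -- The increments `suc (u k / B)` grow with `k`, so each of the `j` steps adds at least the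
    -- first one. For `j = B` the sum exceeds `u k`, which gives `u-double`.
    u-linear : ∀ k j → u k + j * suc (u k / B) ≤ u (j + k)
    u-linear k zero    = ≤-reflexive (+-identityʳ (u k))
    u-linear k (suc j) = begin
      u k + (suc (u k / B) + j * suc (u k / B)) ≡⟨ cong (u k +_) (+-comm (suc (u k / B)) _) ⟩
      u k + (j * suc (u k / B) + suc (u k / B)) ≡⟨ +-assoc (u k) _ _ ⟨
      u k + j * suc (u k / B) + suc (u k / B)   ≤⟨ +-mono-≤ (u-linear k j) (s≤s (/-monoˡ-≤ B (u-mono-≤ (m≤n+m k j)))) ⟩
      u (j + k) + suc (u (j + k) / B)           ≡⟨ +-suc (u (j + k)) _ ⟩
      u (suc (j + k))                           ∎
      where open ≤-Reasoning

    u-double : ∀ k → 2 * u k ≤ u (B + k)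
    u-double k = begin
      u k + (u k + 0)            ≡⟨ cong (u k +_) (+-identityʳ (u k)) ⟩
      u k + u k                  ≡⟨ cong (u k +_) (m≡m%n+[m/n]*n (u k) B) ⟩
      u k + (u k % B + u k / B * B) ≤⟨ +-monoʳ-≤ (u k) (+-monoˡ-≤ _ (<⇒≤ (m%n<n (u k) B))) ⟩
      u k + (B + u k / B * B)    ≡⟨ cong (u k +_) (*-comm (suc (u k / B)) B) ⟩
      u k + B * suc (u k / B)    ≤⟨ u-linear k B ⟩
      u (B + k)                  ∎
      where open ≤-Reasoning

    -- Thus `suc l * B` cells reach all distances when `n < 2 ^ suc l`.
    2^≤u : ∀ i → 2 ^ i ≤ u (i * B)
    2^≤u zero    = ≤-refl
    2^≤u (suc i) = ≤-trans (*-monoʳ-≤ 2 (2^≤u i)) (u-double (i * B))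

    InCell : ∀ {n} → ℕ → Fin n → Fin n → Set
    InCell k c d = u k + toℕ c ≤ toℕ d × toℕ d < u (suc k) + toℕ c

    Occupied : ∀ {n} → (Fin n → Bool) → Fin n → ℕ → Set
    Occupied S c k = ∃ λ d → S d ≡ true × InCell k c d

    occupied? : ∀ {n} (S : Fin n → Bool) c k → Dec (Occupied S c k)
    occupied? S c k = Fin.any? λ d → (S d Bool.≟ true) ×-dec
      (u k + toℕ c ≤? toℕ d) ×-dec (toℕ d <? u (suc k) + toℕ c)

    InCell-< : ∀ {n k l} {c d e : Fin n} → k < l → InCell k c d → InCell l c e → d Fin.< e
    InCell-< k<l (_ , hi) (lo , _) = ≤-trans hi (≤-trans (+-monoˡ-≤ _ (u-mono-≤ k<l)) lo)

    module _ (K : ℕ) where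

      occ : ∀ {n} → (Fin n → Bool) → Fin n → Fin K → Bool
      occ S c k = ⌊ occupied? S c (toℕ k) ⌋

      thin rich : ∀ {n} → ℕ → (Fin n → Bool) → Fin n → Bool
      thin t S c = S c ∧ ⌊ count (occ S c) ≤? t ⌋
      rich t S c = S c ∧ ⌊ t <? count (occ S c) ⌋

      module _ {n : ℕ} (n≤uK : n ≤ u K) where

        cell : ∀ {c d : Fin n} → c Fin.< d → Σ[ k ∈ Fin K ] InCell (toℕ k) c d
        cell {c} {d} c<d with k , lo , hi ← bracket u K {toℕ d ∸ toℕ c} (m<n⇒0<n∸m c<d)
                               (≤-<-trans (m∸n≤m (toℕ d) (toℕ c)) (<-≤-trans (Fin.toℕ<n d) n≤uK)) =
          k , m≤n∸o⇒m+o≤n (u (toℕ k)) c≤d lo , m∸n<o⇒m<o+n c≤d hi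
          where
          c≤d = <⇒≤ c<d
          m≤n∸o⇒m+o≤n : ∀ m {n o} → o ≤ n → m ≤ n ∸ o → m + o ≤ n
          m≤n∸o⇒m+o≤n m {n} {o} o≤n le = ≤-trans (+-monoˡ-≤ o le) (≤-reflexive (m∸n+n≡m o≤n))
          m∸n<o⇒m<o+n : ∀ {m n o} → n ≤ m → m ∸ n < o → m < o + n
          m∸n<o⇒m<o+n {m} {n} n≤m lt = ≤-trans (≤-reflexive (cong suc (sym (m∸n+n≡m n≤m)))) (+-monoˡ-≤ n lt)

        -- If the last element e lies at distance between B^k and B^(k+1) from c,
        -- its cell contains no element at distance B^k or more from e.
        module _ {L : ℕ} (n≤B^L : n ≤ B ^ L) where

          thin-count : ∀ t (S : Fin n → Bool) → count (thin t S) ≤ suc L ^ t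
          -- A later element of `S` would occupy a cell, so an element without occupied cells is the
          -- last one.
          thin-count zero S = count≤ (thin 0 S) (λ _ → zero {0}) λ hc hd _ → unique hc hd
            where
            no-later : ∀ {c d} → thin 0 S c ≡ true → S d ≡ true → ¬ c Fin.< d
            no-later {c} {d} hc Sd c<d with k , inc ← cell c<d =
              contradiction (≤-trans
                (≤-reflexive (sym (⟦⌊⌋⟧-yes (occupied? S c (toℕ k)) (d , Sd , inc))))
                (≤-trans (term≤sum (λ i → ⟦ occ S c i ⟧) k)
                         (witness (count (occ S c) ≤? 0) (proj₂ (∧-elim hc)))))
                λ ()
            unique : ∀ {c d} → thin 0 S c ≡ true → thin 0 S d ≡ true → c ≡ d
            unique {c} {d} hc hd with Fin.<-cmp c d
            ... | tri< c<d _ _ = contradiction c<d (no-later hc (proj₁ (∧-elim hd)))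
            ... | tri≈ _ c≡d _ = c≡d
            ... | tri> _ _ d<c = contradiction d<c (no-later hd (proj₁ (∧-elim hc)))
          thin-count (suc t) S with last-true S
          ... | inj₁ none = begin
            count (thin (suc t) S)  ≤⟨ sum-mono-≤ {g = λ _ → 0} (λ c → ⟦⟧-bound λ h →
                                         contradiction (trans (sym (none c)) (proj₁ (∧-elim h))) λ ()) ⟩
            sum {n} (λ _ → 0)       ≡⟨ trans (sum-const n 0) (*-zeroʳ n) ⟩
            0                       ≤⟨ z≤n ⟩
            suc L ^ suc t           ∎
            where open ≤-Reasoning
          ... | inj₂ (e , Se , max) = begin
            count (thin (suc t) S)
              ≤⟨ sum-mono-≤ split ⟩
            sum (λ c → ⟦ ⌊ c Fin.≟ e ⌋ ⟧ + sum (λ k → ⟦ thin t (far k) c ⟧))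
              ≡⟨ ∑-distrib-+ (λ c → ⟦ ⌊ c Fin.≟ e ⌋ ⟧) _ ⟩
            count (λ c → ⌊ c Fin.≟ e ⌋) + sum (λ c → sum (λ k → ⟦ thin t (far k) c ⟧))
              ≤⟨ ≤-trans (+-monoˡ-≤ _ once) (+-monoʳ-≤ 1 (≤-reflexive (∑-comm (λ c k → ⟦ thin t (far k) c ⟧)))) ⟩
            1 + sum (λ k → count (thin t (far k)))
              -- The 1 for `e` is rounded up to one more copy of the bound that holds for each of
              -- the `L` values of `k`.
              ≤⟨ +-mono-≤ (m^n>0 (suc L) t) (sum-mono-≤ (λ k → thin-count t (far k))) ⟩
            suc L ^ t + sum {L} (λ _ → suc L ^ t)
              ≡⟨ cong (suc L ^ t +_) (sum-const L _) ⟩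
            suc L ^ suc t ∎
            where
            open ≤-Reasoning
            far : Fin L → Fin n → Bool
            far k c = S c ∧ ⌊ B ^ toℕ k + toℕ c ≤? toℕ e ⌋
            once : count (λ c → ⌊ c Fin.≟ e ⌋) ≤ 1
            once = count≤ _ (λ _ → zero {0}) λ {c} {d} hc hd _ →
              trans (witness (c Fin.≟ e) hc) (sym (witness (d Fin.≟ e) hd))
            split : ∀ c → ⟦ thin (suc t) S c ⟧ ≤ ⟦ ⌊ c Fin.≟ e ⌋ ⟧ + sum (λ k → ⟦ thin t (far k) c ⟧)
            split c = ⟦⟧-bound go
              where
              go : thin (suc t) S c ≡ true → 1 ≤ ⟦ ⌊ c Fin.≟ e ⌋ ⟧ + sum (λ k → ⟦ thin t (far k) c ⟧)
              go hc with c Fin.≟ e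
              ... | yes _ = s≤s z≤n
              ... | no c≢e with Sc , few ← ∧-elim {S c} hc
                  with c<e ← Fin.≤∧≢⇒< (max c Sc) c≢e
                  with j , ine ← cell c<e
                  with k , lo , hi ← bracket (B ^_) L {toℕ e ∸ toℕ c} (m<n⇒0<n∸m c<e)
                                    (≤-<-trans (m∸n≤m (toℕ e) (toℕ c)) (<-≤-trans (Fin.toℕ<n e) n≤B^L)) =
                ≤-trans (≤-reflexive (cong ⟦_⟧ (sym thin-c))) (term≤sum (λ k → ⟦ thin t (far k) c ⟧) k)
                where
                far-c : far k c ≡ true
                far-c = ∧-intro Sc (⌊⌋≡true (_ ≤? _)
                  (≤-trans (+-monoˡ-≤ (toℕ c) lo) (≤-reflexive (m∸n+n≡m (<⇒≤ c<e)))))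
                not-occ : ¬ Occupied (far k) c (toℕ j)
                not-occ (d , hd , lod , _) = <⇒≱ hi (begin
                  B * B ^ toℕ k              ≡⟨ *-comm B _ ⟩
                  B ^ toℕ k * B              ≤⟨ *-monoˡ-≤ B gap ⟩
                  u (toℕ j) / B * B          ≤⟨ m/n*n≤m (u (toℕ j)) B ⟩
                  u (toℕ j)                  ≡⟨ m+n∸n≡m (u (toℕ j)) (toℕ c) ⟨
                  u (toℕ j) + toℕ c ∸ toℕ c  ≤⟨ ∸-monoˡ-≤ (toℕ c) (proj₁ ine) ⟩
                  toℕ e ∸ toℕ c              ∎)
                  where
                  -- `d` and `e` lie in the same cell, so they are at most `u (toℕ j) / B` apart,
                  -- while membership in `far k` puts `d` at least `B ^ toℕ k` before `e`.
                  gap : B ^ toℕ k ≤ u (toℕ j) / B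
                  gap = +-cancelʳ-≤ (toℕ d) _ _ (begin
                    B ^ toℕ k + toℕ d                      ≤⟨ witness (_ ≤? _) (proj₂ (∧-elim {S d} hd)) ⟩
                    toℕ e                                  ≤⟨ s≤s⁻¹ (proj₂ ine) ⟩
                    u (toℕ j) + u (toℕ j) / B + toℕ c      ≡⟨ cong (_+ toℕ c) (+-comm (u (toℕ j)) _) ⟩
                    u (toℕ j) / B + u (toℕ j) + toℕ c      ≡⟨ +-assoc (u (toℕ j) / B) _ _ ⟩
                    u (toℕ j) / B + (u (toℕ j) + toℕ c)    ≤⟨ +-monoʳ-≤ _ lod ⟩
                    u (toℕ j) / B + toℕ d                  ∎)
                -- Passing from `S` to `far k` vacates the cell of `e` and occupies no new one.
                fewer : count (occ (far k) c) < count (occ S c)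
                fewer = count-mono-<
                  (λ i h → let d , hd , p = witness (occupied? (far k) c (toℕ i)) h in
                    ⌊⌋≡true (occupied? S c (toℕ i)) (d , proj₁ (∧-elim {S d} hd) , p))
                  j (⌊⌋≡false (occupied? (far k) c (toℕ j)) not-occ)
                  (⌊⌋≡true (occupied? S c (toℕ j)) (e , Se , ine))
                  where
                  ⌊⌋≡false : ∀ {a} {P : Set a} (P? : Dec P) → ¬ P → ⌊ P? ⌋ ≡ false
                  ⌊⌋≡false (yes p) ¬p = contradiction p ¬p
                  ⌊⌋≡false (no _)  _  = refl
                thin-c : thin t (far k) c ≡ true
                thin-c = ∧-intro far-c (⌊⌋≡true (_ ≤? _)
                  (s≤s⁻¹ (≤-trans fewer (witness (_ ≤? suc t) few))))

  -- The row of the only 1 of P_t in a column j ≥ 1; column 0 has two 1s and is assigned to row 1.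
  rowOf : ℕ → Fin 2
  rowOf zero          = 1F
  rowOf (suc zero)    = 0F
  rowOf (suc (suc p)) = rowOf p

  2+p%2≡p%2 : ∀ p → (2 + p) % 2 ≡ p % 2
  2+p%2≡p%2 p = trans (cong (_% 2) (+-comm 2 p)) ([m+n]%n≡m%n p 2)

  rowOf-0F : ∀ {p} → rowOf p ≡ 0F → p % 2 ≡ 1
  rowOf-0F {suc zero}    _  = refl
  rowOf-0F {suc (suc p)} eq = trans (2+p%2≡p%2 p) (rowOf-0F {p} eq)

  rowOf-1F : ∀ {p} → rowOf p ≡ 1F → p % 2 ≡ 0
  rowOf-1F {zero}        _  = refl
  rowOf-1F {suc (suc p)} eq = trans (2+p%2≡p%2 p) (rowOf-1F {p} eq)

  alternating-zero : ∀ t i (q : Fin (t + 2)) → toℕ q ≡ 0 → alternating t i q ≡ true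
  alternating-zero t i q eq with toℕ q
  alternating-zero t i q refl | zero = refl

  alternating-rowOf : ∀ t (q : Fin (t + 2)) → alternating t (rowOf (toℕ q)) q ≡ true
  alternating-rowOf t q with toℕ q in eq
  ... | zero = refl
  ... | suc p with rowOf (suc p) in eq'
  ...   | 0F = ⌊⌋≡true (_ ≟ 1) (rowOf-0F {suc p} eq')
  ...   | 1F = ⌊⌋≡true (_ ≟ 0) (rowOf-1F {suc p} eq')

  alternating⇒rowOf : ∀ t i (q : Fin (t + 2)) {p} → toℕ q ≡ suc p →
                      alternating t i q ≡ true → rowOf (suc p) ≡ i
  alternating⇒rowOf t i q eq h with toℕ q
  alternating⇒rowOf t 0F q {p} refl h | suc p with rowOf (suc p) in eq'
  ... | 0F = refl
  ... | 1F = contradiction (trans (sym (witness (_ ≟ 1) h)) (rowOf-1F {suc p} eq')) λ ()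
  alternating⇒rowOf t 1F q {p} refl h | suc p with rowOf (suc p) in eq'
  ... | 0F = contradiction (trans (sym (witness (_ ≟ 0) h)) (rowOf-0F {suc p} eq')) λ ()
  ... | 1F = refl

  -- A row that provides the odd positions (counting from 0) may differ from the other row at all
  -- even ones; ignoring only two of them leaves t - 1 positions.
  keep : ∀ {s} → Fin (suc s) → Fin (3 + s)
  keep zero    = suc zero
  keep (suc q) = suc (suc (suc q))

  keep-odd : ∀ {s} (p : Fin (3 + s)) → rowOf (suc (toℕ p)) ≡ 1F → Σ[ q ∈ Fin (suc s) ] keep q ≡ p
  keep-odd (suc zero)          _ = zero , refl
  keep-odd (suc (suc (suc q))) _ = suc q , refl

  funToFin-injective : ∀ {m n} {f g : Fin m → Fin n} → funToFin f ≡ funToFin g → ∀ i → f i ≡ g i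
  funToFin-injective {f = f} {g} eq i = trans (sym (Fin.finToFun-funToFin f i))
    (trans (cong (λ c → finToFun c i) eq) (Fin.finToFun-funToFin g i))

  -- Rich 1s in a column

  module _ (B : ℕ) .{{_ : NonZero B}} (K : ℕ) {n s : ℕ} (A : Matrix n n) where

    private
      t = 2 + s

      Chain : Fin n → Fin n → Set
      Chain r c = Σ[ k ∈ (Fin (3 + s) → Fin K) ] StrictlyIncreasing k × (∀ p → occ B K (A r) c (k p) ≡ true)

      chain : ∀ {r c} → rich B K t (A r) c ≡ true → Chain r c
      chain {r} {c} h = enumerate (occ B K (A r) c) (3 + s) (witness (t <? _) (proj₂ (∧-elim {A r c} h)))

    -- Row r takes its points from its own cells, row r′ needs only the cells of r at odd positions.
    same-type⇒contains : ∀ {r r′ c} → r Fin.< r′ → A r c ≡ true → A r′ c ≡ true →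
                         ((k , _) : Chain r c) ((k′ , _) : Chain r′ c) →
                         (∀ q → k (keep q) ≡ k′ (keep q)) → A Contains alternating t
    same-type⇒contains {r} {r′} {c} r<r′ Ac A′c (k , inc , occupied) (k′ , _ , occupied′) same =
      ρ , γ ∘ Fin.cast eq , ρ-inc , γ-inc , sound
      where
      eq : t + 2 ≡ 2 + t
      eq = +-comm t 2

      ρ : Fin 2 → Fin n
      ρ 0F = r
      ρ 1F = r′

      ρ-inc : StrictlyIncreasing ρ
      ρ-inc {0F} {1F} _ = r<r′
      ρ-inc {1F} {1F} (s≤s ())

      pick : ∀ p → Σ[ d ∈ Fin n ] A (ρ (rowOf (suc (toℕ p)))) d ≡ true × InCell B (toℕ (k p)) c d
      pick p with rowOf (suc (toℕ p)) in odd
      ... | 0F = witness (occupied? B (A r) c (toℕ (k p))) (occupied p)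
      ... | 1F with q , refl ← keep-odd p odd
               with d , Ad , cell ← witness (occupied? B (A r′) c (toℕ (k′ p))) (occupied′ p) =
        d , Ad , subst (λ x → InCell B (toℕ x) c d) (sym (same q)) cell

      γ : Fin (2 + t) → Fin n
      γ zero    = c
      γ (suc p) = proj₁ (pick p)

      γ-inc′ : StrictlyIncreasing γ
      γ-inc′ {zero}  {suc q} _ with _ , _ , lo , _ ← pick q = ≤-trans (+-monoˡ-≤ (toℕ c) (1≤u B (toℕ (k q)))) lo
      γ-inc′ {suc p} {suc q} p<q with _ , _ , cell ← pick p | _ , _ , cell′ ← pick q =
        InCell-< B {k = toℕ (k p)} (inc (s≤s⁻¹ p<q)) cell cell′

      γ-inc : StrictlyIncreasing (γ ∘ Fin.cast eq)
      γ-inc {i} {j} i<j = γ-inc′ (subst₂ _<_ (sym (Fin.toℕ-cast eq i)) (sym (Fin.toℕ-cast eq j)) i<j)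

      A-ρ : ∀ i → A (ρ i) c ≡ true
      A-ρ 0F = Ac
      A-ρ 1F = A′c

      sound : ∀ i j → alternating t i j ≡ true → A (ρ i) (γ (Fin.cast eq j)) ≡ true
      sound i j h with Fin.cast eq j in cj
      ... | zero  = A-ρ i
      ... | suc p = subst (λ x → A (ρ x) (γ (suc p)) ≡ true)
        (alternating⇒rowOf t i j (trans (sym (Fin.toℕ-cast eq j)) (cong toℕ cj)) h) (proj₁ (proj₂ (pick p)))

    -- Pigeonhole on the cells at the `suc s`, that is `t - 1`, positions of `keep`: two 1s of the
    -- column with the same code yield a copy of the pattern.
    rich-count : A Avoids alternating t → ∀ c → count (λ r → rich B K t (A r) c) ≤ K ^ suc s
    rich-count free c = count≤ (λ r → rich B K t (A r) c)
      (λ h → funToFin (proj₁ (chain h) ∘ keep)) inj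
      where
      clash : ∀ {r r′} (h : rich B K t (A r) c ≡ true) (h′ : rich B K t (A r′) c ≡ true) →
              r Fin.< r′ → (∀ q → proj₁ (chain h) (keep q) ≡ proj₁ (chain h′) (keep q)) → A Contains alternating t
      clash h h′ r<r′ = same-type⇒contains r<r′ (proj₁ (∧-elim h)) (proj₁ (∧-elim h′)) (chain h) (chain h′)
      inj : ∀ {r r′} (h : rich B K t (A r) c ≡ true) (h′ : rich B K t (A r′) c ≡ true) →
            funToFin (proj₁ (chain h) ∘ keep) ≡ funToFin (proj₁ (chain h′) ∘ keep) → r ≡ r′
      inj {r} {r′} h h′ eq with Fin.<-cmp r r′
      ... | tri< r<r′ _ _ = contradiction (clash h h′ r<r′ (funToFin-injective eq)) free
      ... | tri≈ _ r≡r′ _ = r≡r′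
      ... | tri> _ _ r′<r = contradiction (clash h′ h r′<r (funToFin-injective (sym eq))) free

    -- Thin 1s are counted row by row, rich ones column by column; these are the two terms.
    ones≤ : A Avoids alternating t → ∀ {L} → n ≤ u B K → n ≤ B ^ L → ones A ≤ n * (suc L ^ t + K ^ suc s)
    ones≤ free {L} n≤uK n≤B^L = begin
      ones A
        ≤⟨ sum-mono-≤ (λ r → sum-mono-≤ (λ c → split r c)) ⟩
      sum (λ r → sum (λ c → ⟦ thin B K t (A r) c ⟧ + ⟦ rich B K t (A r) c ⟧))
        ≤⟨ sum-mono-≤ (λ r → ≤-reflexive (∑-distrib-+ (λ c → ⟦ thin B K t (A r) c ⟧) _)) ⟩
      sum (λ r → count (thin B K t (A r)) + count (rich B K t (A r)))
        ≡⟨ ∑-distrib-+ (λ r → count (thin B K t (A r))) _ ⟩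
      sum (λ r → count (thin B K t (A r))) + sum (λ r → count (rich B K t (A r)))
        ≡⟨ cong (sum (λ r → count (thin B K t (A r))) +_) (∑-comm (λ r c → ⟦ rich B K t (A r) c ⟧)) ⟩
      sum (λ r → count (thin B K t (A r))) + sum (λ c → count (λ r → rich B K t (A r) c))
        ≤⟨ +-mono-≤ (sum-mono-≤ (λ r → thin-count B K n≤uK n≤B^L t (A r))) (sum-mono-≤ (rich-count free)) ⟩
      sum {n} (λ _ → suc L ^ t) + sum {n} (λ _ → K ^ suc s)
        ≡⟨ cong₂ _+_ (sum-const n _) (sum-const n _) ⟩
      n * suc L ^ t + n * K ^ suc s
        ≡⟨ *-distribˡ-+ n _ _ ⟨
      n * (suc L ^ t + K ^ suc s) ∎
      where
      open ≤-Reasoning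
      split : ∀ r c → ⟦ A r c ⟧ ≤ ⟦ thin B K t (A r) c ⟧ + ⟦ rich B K t (A r) c ⟧
      split r c = ⟦⟧-bound λ Arc → go Arc (count (occ B K (A r) c) ≤? t)
        where
        go : A r c ≡ true → Dec (count (occ B K (A r) c) ≤ t) → 1 ≤ ⟦ thin B K t (A r) c ⟧ + ⟦ rich B K t (A r) c ⟧
        go Arc (yes few) = ≤-trans (≤-reflexive (cong ⟦_⟧ (sym (∧-intro Arc (⌊⌋≡true (_ ≤? t) few))))) (m≤m+n _ _)
        go Arc (no many) = ≤-trans (≤-reflexive (cong ⟦_⟧ (sym (∧-intro Arc (⌊⌋≡true (t <? _) (≰⇒> many))))))
          (m≤n+m _ ⟦ thin B K t (A r) c ⟧)

  -- Choosing `B` as a small power of `log n`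

  ^-distribʳ-* : ∀ k m n → (m * n) ^ k ≡ m ^ k * n ^ k
  ^-distribʳ-* zero    m n = refl
  ^-distribʳ-* (suc k) m n = trans (cong (m * n *_) (^-distribʳ-* k m n)) (interchange m n (m ^ k) (n ^ k))
    where
    interchange : ∀ a b c d → a * b * (c * d) ≡ a * c * (b * d)
    interchange = solve-∀

  n<2^n : ∀ n → n < 2 ^ n
  n<2^n zero    = s≤s z≤n
  n<2^n (suc n) = ≤-trans (s≤s (n<2^n n)) (≤-trans (+-monoˡ-≤ (2 ^ n) (m^n>0 2 n))
    (≤-reflexive (cong (2 ^ n +_) (sym (+-identityʳ _)))))

  m<suc[m/n]*n : ∀ m n .{{_ : NonZero n}} → m < suc (m / n) * n
  m<suc[m/n]*n m n = ≤-trans (≤-reflexive (cong suc (m≡m%n+[m/n]*n m n))) (+-monoˡ-< _ (m%n<n m n))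

  add-bounds : ∀ n {a b c₁ c₂} x y → a * x ≤ c₁ * y → b * x ≤ c₂ * y → n * (a + b) * x ≤ (c₁ + c₂) * (n * y)
  add-bounds n {a} {b} {c₁} {c₂} x y a≤ b≤ = begin
    n * (a + b) * x           ≡⟨ distrib n a b x ⟩
    n * (a * x + b * x)       ≤⟨ *-monoʳ-≤ n (+-mono-≤ a≤ b≤) ⟩
    n * (c₁ * y + c₂ * y)     ≡⟨ collect n c₁ c₂ y ⟩
    (c₁ + c₂) * (n * y)       ∎
    where
    open ≤-Reasoning
    distrib : ∀ n a b c → n * (a + b) * c ≡ n * (a * c + b * c)
    distrib = solve-∀
    collect : ∀ n a b c → n * (a * c + b * c) ≡ (a + b) * (n * c)
    collect = solve-∀

  module _ (s : ℕ) where

    private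
      t = 2 + s
      C₁ = (12 * t) ^ t
      C₂ = 2 ^ suc s * (4 * t) ^ t

    -- Here `B = 2 ^ w`, and `l` and `v` stand for `log n` and `log log n`. The base is at most
    -- `4 * t * (w + w + l)`, hence `12 * t * l`; `suc (suc (l / w))` is the `suc L` of `ones≤`.
    row-bound : ∀ {l v w} .{{_ : NonZero w}} → w ≤ l → v ≤ 4 * t * w → suc (suc (l / w)) ^ t * v ^ t ≤ C₁ * l ^ t
    row-bound {l} {v} {w} w≤l v≤ = begin
      suc (suc (l / w)) ^ t * v ^ t  ≡⟨ ^-distribʳ-* t (suc (suc (l / w))) v ⟨
      (suc (suc (l / w)) * v) ^ t    ≤⟨ ^-monoˡ-≤ t base ⟩
      (12 * t * l) ^ t               ≡⟨ ^-distribʳ-* t (12 * t) l ⟩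
      C₁ * l ^ t                     ∎
      where
      open ≤-Reasoning
      e₁ : ∀ q t w → (2 + q) * (4 * t * w) ≡ 4 * t * (w + w + q * w)
      e₁ = solve-∀
      e₂ : ∀ t l → 4 * t * (l + l + l) ≡ 12 * t * l
      e₂ = solve-∀
      base : suc (suc (l / w)) * v ≤ 12 * t * l
      base = begin
        suc (suc (l / w)) * v               ≤⟨ *-monoʳ-≤ (suc (suc (l / w))) v≤ ⟩
        suc (suc (l / w)) * (4 * t * w)     ≡⟨ e₁ (l / w) t w ⟩
        4 * t * (w + w + l / w * w)         ≤⟨ *-monoʳ-≤ (4 * t) (+-mono-≤ (+-mono-≤ w≤l w≤l) (m/n*n≤m l w)) ⟩
        4 * t * (l + l + l)                 ≡⟨ e₂ t l ⟩
        12 * t * l                          ∎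

    -- The factor `2 ^ w` occurs `t - 1` times in the number of codes and, as a bound for `w`, `t`
    -- times in `v ^ t`. Together these cost at most one factor `l`, which completes `l ^ suc s` to
    -- `l ^ t`.
    column-bound : ∀ {l v w} → 1 ≤ l → v ≤ 4 * t * w → 2 ^ (w * (2 * t)) ≤ l →
                   (suc l * 2 ^ w) ^ suc s * v ^ t ≤ C₂ * l ^ t
    column-bound {l} {v} {w} 1≤l v≤ 2^≤l = begin
      (suc l * 2 ^ w) ^ suc s * v ^ t
        ≤⟨ *-mono-≤ (^-monoˡ-≤ (suc s) (*-monoˡ-≤ (2 ^ w) suc-l≤)) (^-monoˡ-≤ t (≤-trans v≤ (*-monoʳ-≤ (4 * t) (<⇒≤ (n<2^n w))))) ⟩
      (2 * l * 2 ^ w) ^ suc s * (4 * t * 2 ^ w) ^ t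
        ≡⟨ cong₂ _*_ (trans (^-distribʳ-* (suc s) (2 * l) (2 ^ w)) (cong (_* (2 ^ w) ^ suc s) (^-distribʳ-* (suc s) 2 l)))
                     (^-distribʳ-* t (4 * t) (2 ^ w)) ⟩
      2 ^ suc s * l ^ suc s * (2 ^ w) ^ suc s * ((4 * t) ^ t * (2 ^ w) ^ t)
        ≡⟨ shuffle (2 ^ suc s) (l ^ suc s) ((2 ^ w) ^ suc s) ((4 * t) ^ t) ((2 ^ w) ^ t) ⟩
      C₂ * (((2 ^ w) ^ suc s * (2 ^ w) ^ t) * l ^ suc s)
        ≤⟨ *-monoʳ-≤ C₂ (*-monoˡ-≤ (l ^ suc s) small) ⟩
      C₂ * l ^ t ∎
      where
      open ≤-Reasoning
      shuffle : ∀ a b c d e → a * b * c * (d * e) ≡ a * d * ((c * e) * b)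
      shuffle = solve-∀
      suc-l≤ : suc l ≤ 2 * l
      suc-l≤ = ≤-trans (+-monoˡ-≤ l 1≤l) (≤-reflexive (cong (l +_) (sym (+-identityʳ l))))
      small : (2 ^ w) ^ suc s * (2 ^ w) ^ t ≤ l
      small = begin
        (2 ^ w) ^ suc s * (2 ^ w) ^ t ≡⟨ ^-distribˡ-+-* (2 ^ w) (suc s) t ⟨
        (2 ^ w) ^ (suc s + t)         ≡⟨ ^-*-assoc 2 w (suc s + t) ⟩
        2 ^ (w * (suc s + t))         ≤⟨ ^-monoʳ-≤ 2 (*-monoʳ-≤ w (+-mono-≤ (n≤1+n (suc s)) (m≤m+n t 0))) ⟩
        2 ^ (w * (2 * t))             ≤⟨ 2^≤l ⟩
        l                             ∎

    Ex-upper-scale : ∀ {n l v w} .{{_ : NonZero w}} → n < 2 ^ suc l → 1 ≤ l → w ≤ l → v ≤ 4 * t * w →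
                     2 ^ (w * (2 * t)) ≤ l → Ex (alternating t) n * v ^ t ≤ (C₁ + C₂) * (n * l ^ t)
    Ex-upper-scale {n} {l} {v} {w} n< 1≤l w≤l v≤ 2^w≤l
      with A , free , ones≡ ← Ex-attained (alternating t) {n}
             -- The zero matrix avoids the pattern, so the maximum is attained.
             ((λ _ _ → false) , λ (_ , _ , _ , _ , h) → contradiction (h 0F 0F refl) λ ()) =
      ≤-trans (*-monoˡ-≤ (v ^ t) (≤-trans (≤-reflexive (sym ones≡))
                (ones≤ B K A free {suc (l / w)} (≤-trans (<⇒≤ n<) (2^≤u B (suc l))) n≤B^L)))
              (add-bounds n {suc (suc (l / w)) ^ t} {K ^ suc s} {C₁} {C₂} (v ^ t) (l ^ t)
                (row-bound {w = w} w≤l v≤) (column-bound {w = w} 1≤l v≤ 2^w≤l))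
      where
      open ≤-Reasoning
      B = 2 ^ w
      instance
        B≢0 : NonZero B
        B≢0 = m^n≢0 2 w
      K = suc l * B
      n≤B^L : n ≤ B ^ suc (l / w)
      n≤B^L = begin
        n                       ≤⟨ <⇒≤ n< ⟩
        2 ^ suc l               ≤⟨ ^-monoʳ-≤ 2 (m<suc[m/n]*n l w) ⟩
        2 ^ (suc (l / w) * w)   ≡⟨ cong (2 ^_) (*-comm (suc (l / w)) w) ⟩
        2 ^ (w * suc (l / w))   ≡⟨ ^-*-assoc 2 w (suc (l / w)) ⟨
        B ^ suc (l / w)         ∎

    -- `w = v / (2 * t)` is the largest choice with `2 ^ (w * (2 * t)) ≤ 2 ^ v`. It is positive by
    -- `2 * t ≤ v`, so rounding costs at most a factor 2.
    Ex-upper : ∃ λ C → ∀ {n l v} → n < 2 ^ suc l → 2 ^ v ≤ l → 2 * t ≤ v →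
               Ex (alternating t) n * v ^ t ≤ C * (n * l ^ t)
    Ex-upper = C₁ + C₂ , λ {n} {l} {v} n< 2^v≤l 2t≤v →
      let w≢0 = >-nonZero (m≥n⇒m/n>0 2t≤v)
          v≤l = ≤-trans (<⇒≤ (n<2^n v)) 2^v≤l
      in Ex-upper-scale {w = v / (2 * t)} {{w≢0}} n<
           (≤-trans (m^n>0 2 v) 2^v≤l)
           (≤-trans (m/n≤m v (2 * t)) v≤l)
           (v≤ v (v / (2 * t)) {{w≢0}} (<⇒≤ (m<suc[m/n]*n v (2 * t))))
           (≤-trans (^-monoʳ-≤ 2 (m/n*n≤m v (2 * t))) 2^v≤l)
      where
      open ≤-Reasoning
      four : ∀ t w → (w + w) * (2 * t) ≡ 4 * t * w
      four = solve-∀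
      v≤ : ∀ v w .{{_ : NonZero w}} → v ≤ suc w * (2 * t) → v ≤ 4 * t * w
      v≤ v w v≤′ = begin
        v                  ≤⟨ v≤′ ⟩
        suc w * (2 * t)    ≤⟨ *-monoˡ-≤ (2 * t) (+-monoˡ-≤ w (>-nonZero⁻¹ w)) ⟩
        (w + w) * (2 * t)  ≡⟨ four t w ⟩
        4 * t * w          ∎

  -- The lower bound

  combine-<⇒ : ∀ {m n} {i i′ : Fin m} {j j′ : Fin n} → combine i j Fin.< combine i′ j′ →
               i Fin.< i′ ⊎ i ≡ i′ × j Fin.< j′
  combine-<⇒ {n = n} {i} {i′} {j} {j′} lt with Fin.<-cmp i i′
  ... | tri< i<i′ _ _ = inj₁ i<i′
  ... | tri≈ _ refl _ = inj₂ (refl , +-cancelˡ-< (n * toℕ i) _ _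
    (subst₂ _<_ (Fin.toℕ-combine i j) (Fin.toℕ-combine i j′) lt))
  ... | tri> _ _ i′<i = contradiction lt (<-asym (Fin.combine-monoˡ-< j′ j i′<i))

  combine-<⇒≤ : ∀ {m n} {i i′ : Fin m} {j j′ : Fin n} → combine i j Fin.< combine i′ j′ → i Fin.≤ i′
  combine-<⇒≤ lt with combine-<⇒ lt
  ... | inj₁ i<i′       = <⇒≤ i<i′
  ... | inj₂ (refl , _) = ≤-refl

  scale-injective : ∀ {q v} → 2 ≤ q → 1 ≤ v → ∀ a {i j} → a + v * q ^ i ≡ a + v * q ^ j → i ≡ j
  scale-injective {q} {v} 2≤q 1≤v a {i} {j} eq with <-cmp i j
  ... | tri< i<j _ _ = contradiction eq (<⇒≢ (+-monoʳ-< a (*-monoʳ-< v {{>-nonZero 1≤v}} (^-monoʳ-< q 2≤q i<j))))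
  ... | tri≈ _ i≡j _ = i≡j
  ... | tri> _ _ j<i = contradiction (sym eq) (<⇒≢ (+-monoʳ-< a (*-monoʳ-< v {{>-nonZero 1≤v}} (^-monoʳ-< q 2≤q j<i))))

  -- The row with offset a has larger steps than the row with offset a′, so it starts at least
  -- q^i to the left of it; hence it reaches the other row's part of the block only in scale i.
  same-scale : ∀ {q v v′ a a′ i i₁ i₂} → 2 ≤ q → v′ < v → v ≤ q → 1 ≤ v′ →
               a + v * q ^ i ≡ a′ + v′ * q ^ i →
               a′ + v′ * q ^ i₂ ≤ a + v * q ^ i₁ → a + v * q ^ i₁ ≤ a + v * q ^ i → i₁ ≡ i
  same-scale {q} {v} {v′} {a} {a′} {i} {i₁} {i₂} 2≤q v′<v v≤q 1≤v′ common lo hi with <-cmp i₁ i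
  ... | tri≈ _ i₁≡i _ = i₁≡i
  ... | tri> _ _ i<i₁ = contradiction hi (<⇒≱ (+-monoʳ-< a (*-monoʳ-< v {{>-nonZero (<-≤-trans 1≤v′ (<⇒≤ v′<v))}} (^-monoʳ-< q 2≤q i<i₁))))
  ... | tri< i₁<i _ _ = contradiction lo (<⇒≱ (begin-strict
    a + v * q ^ i₁       ≤⟨ +-monoʳ-≤ a (*-monoˡ-≤ (q ^ i₁) v≤q) ⟩
    a + q ^ suc i₁       ≤⟨ +-monoʳ-≤ a (^-monoʳ-≤ q i₁<i) ⟩
    a + q ^ i            ≤⟨ left ⟩
    a′                   <⟨ m<m+n a′ (*-mono-≤ 1≤v′ (m^n>0 q i₂)) ⟩
    a′ + v′ * q ^ i₂     ∎))
    where
    open ≤-Reasoning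
    instance
      q≢0 : NonZero q
      q≢0 = >-nonZero (<-≤-trans z<s 2≤q)
    left : a + q ^ i ≤ a′
    left = +-cancelʳ-≤ (v′ * q ^ i) _ _ (begin
      a + q ^ i + v′ * q ^ i   ≡⟨ +-assoc a _ _ ⟩
      a + suc v′ * q ^ i       ≤⟨ +-monoʳ-≤ a (*-monoˡ-≤ (q ^ i) v′<v) ⟩
      a + v * q ^ i            ≡⟨ common ⟩
      a′ + v′ * q ^ i          ∎)

  lex-injective : ∀ {b j j′ β β′} → 1 ≤ β′ → β < b → j * b + β ≡ j′ * b + β′ → β′ < b → 1 ≤ β → j ≡ j′ × β ≡ β′
  lex-injective {b} {j} {j′} {β} {β′} 1≤β′ β<b eq β′<b 1≤β with <-cmp j j′
  ... | tri≈ _ refl _ = refl , +-cancelˡ-≡ (j * b) _ _ eq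
  ... | tri< j<j′ _ _ = contradiction eq (<⇒≢ (begin-strict
    j * b + β      <⟨ +-monoʳ-< (j * b) β<b ⟩
    j * b + b      ≡⟨ +-comm (j * b) b ⟩
    suc j * b      ≤⟨ *-monoˡ-≤ b j<j′ ⟩
    j′ * b         ≤⟨ m≤m+n _ β′ ⟩
    j′ * b + β′    ∎))
    where open ≤-Reasoning
  ... | tri> _ _ j′<j = contradiction (sym eq) (<⇒≢ (begin-strict
    j′ * b + β′    <⟨ +-monoʳ-< (j′ * b) β′<b ⟩
    j′ * b + b     ≡⟨ +-comm (j′ * b) b ⟩
    suc j′ * b     ≤⟨ *-monoˡ-≤ b j′<j ⟩
    j * b          ≤⟨ m≤m+n _ β ⟩
    j * b + β      ∎))
    where open ≤-Reasoning

  -- The order of the shifts forces `j′ ≤ j`. If `j′ = j`, then `β′ < β` and the term of scale `j₁`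
  -- is at most `b ^ j`. If `j′ < j`, both terms live below scale `j`, and
  -- `β′ + β ≤ β * suc β′ ≤ β * b`.
  drop-scale : ∀ {b j j′ β β′ j₁} → j′ * b + β′ < j * b + β → β < b → β′ < b → 1 ≤ β → j₁ < j →
               β′ * b ^ j′ + β * b ^ j₁ ≤ β * b ^ j
  drop-scale {b} {suc j} {j′} {β} {β′} {j₁} lex β<b β′<b 1≤β (s≤s j₁≤j) with <-cmp j′ (suc j)
  ... | tri> _ _ j<j′ = contradiction lex (<⇒≯ (begin-strict
    suc j * b + β   <⟨ +-monoʳ-< (suc j * b) β<b ⟩
    suc j * b + b   ≡⟨ +-comm (suc j * b) b ⟩
    suc (suc j) * b ≤⟨ *-monoˡ-≤ b j<j′ ⟩
    j′ * b          ≤⟨ m≤m+n _ β′ ⟩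
    j′ * b + β′     ∎))
    where open ≤-Reasoning
  ... | tri≈ _ refl _ = begin
    β′ * (b * b ^ j) + β * b ^ j₁      ≤⟨ +-monoʳ-≤ _ (*-mono-≤ (<⇒≤ β<b) (^-monoʳ-≤ b j₁≤j)) ⟩
    β′ * (b * b ^ j) + b * b ^ j       ≡⟨ +-comm (β′ * (b * b ^ j)) _ ⟩
    suc β′ * (b * b ^ j)               ≤⟨ *-monoˡ-≤ (b * b ^ j) (+-cancelˡ-< (suc j * b) _ _ lex) ⟩
    β * (b * b ^ j)                    ∎
    where
    open ≤-Reasoning
    instance
      b≢0 : NonZero b
      b≢0 = >-nonZero (≤-trans (s≤s z≤n) β<b)
  ... | tri< (s≤s j′≤j) _ _ = begin
    β′ * b ^ j′ + β * b ^ j₁     ≤⟨ +-mono-≤ (*-monoʳ-≤ β′ (^-monoʳ-≤ b j′≤j)) (*-monoʳ-≤ β (^-monoʳ-≤ b j₁≤j)) ⟩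
    β′ * b ^ j + β * b ^ j       ≤⟨ +-monoˡ-≤ _ (*-monoˡ-≤ (b ^ j) (m≤n*m β′ β {{>-nonZero 1≤β}})) ⟩
    β * β′ * b ^ j + β * b ^ j   ≡⟨ factor β β′ (b ^ j) ⟩
    β * (suc β′ * b ^ j)         ≤⟨ *-monoʳ-≤ β (*-monoˡ-≤ (b ^ j) β′<b) ⟩
    β * (b * b ^ j)              ∎
    where
    open ≤-Reasoning
    instance
      b≢0 : NonZero b
      b≢0 = >-nonZero (≤-trans (s≤s z≤n) β<b)
    factor : ∀ β β′ x → β * β′ * x + β * x ≡ β * ((1 + β′) * x)
    factor = solve-∀

  rowOf-suc : ∀ p → rowOf p ≡ 1F × rowOf (suc p) ≡ 0F ⊎ rowOf p ≡ 0F × rowOf (suc p) ≡ 1F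
  rowOf-suc zero          = inj₁ (refl , refl)
  rowOf-suc (suc zero)    = inj₂ (refl , refl)
  rowOf-suc (suc (suc p)) = rowOf-suc p

  -- Jumps in `T` coordinates

  module Levels (m Q W : ℕ) (2≤Q : 2 ≤ Q) where

    A = Q ^ m

    instance
      Q≢0 : NonZero Q
      Q≢0 = >-nonZero (<-≤-trans z<s 2≤Q)

    step : Fin 2 → Fin Q → ℕ
    step 0F h = suc (toℕ h)
    step 1F h = Q ∸ toℕ h

    1≤step : ∀ i h → 1 ≤ step i h
    1≤step 0F h = s≤s z≤n
    1≤step 1F h = m<n⇒0<n∸m (Fin.toℕ<n h)

    step≤Q : ∀ i h → step i h ≤ Q
    step≤Q 0F h = Fin.toℕ<n h
    step≤Q 1F h = m∸n≤m Q (toℕ h)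

    coord : Fin 2 → Fin Q → Fin A → Fin m → ℕ
    coord i h a ι = toℕ a + step i h * Q ^ toℕ ι

    coord< : ∀ i h a ι → coord i h a ι < 2 * A
    coord< i h a ι = begin-strict
      toℕ a + step i h * Q ^ toℕ ι <⟨ +-mono-<-≤ (Fin.toℕ<n a) (*-monoˡ-≤ _ (step≤Q i h)) ⟩
      A + Q ^ suc (toℕ ι)          ≤⟨ +-monoʳ-≤ A (^-monoʳ-≤ Q (Fin.toℕ<n ι)) ⟩
      A + A                        ≡⟨ cong (A +_) (+-identityʳ A) ⟨
      2 * A                        ∎
      where open ≤-Reasoning

    lead : Fin 2 → Fin Q → Fin A → Fin m → Fin (2 * A)
    lead i h a ι = fromℕ< (coord< i h a ι)

    toℕ-lead : ∀ i h a ι → toℕ (lead i h a ι) ≡ coord i h a ι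
    toℕ-lead i h a ι = Fin.toℕ-fromℕ< (coord< i h a ι)

    lead≡⇒coord≡ : ∀ i h a ι h′ a′ ι′ → lead i h a ι ≡ lead i h′ a′ ι′ → coord i h a ι ≡ coord i h′ a′ ι′
    lead≡⇒coord≡ i h a ι h′ a′ ι′ eq = trans (sym (toℕ-lead i h a ι)) (trans (cong toℕ eq) (toℕ-lead i h′ a′ ι′))

    width : ℕ → ℕ
    width zero    = W
    width (suc T) = 2 * A * width T

    -- The steps at consecutive levels depend on h in opposite ways, so that the row of the last
    -- column in play, which moves by one from level to level, always has the smaller step.
    column : ∀ T → Fin Q → (Fin T → Fin A) → (Fin T → Fin m) → Fin W → Fin (width T)
    column zero    h a ι w = w
    column (suc T) h a ι w = combine (lead (rowOf (suc T)) h (a zero) (ι zero))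
                                     (column T h (a ∘ suc) (ι ∘ suc) w)

    -- The bottom part is carried along unchanged, so rows that meet in a column agree in it,
    -- including the scales recorded there. Subtracting the known jumps then recovers the offsets.
    column-injective : ∀ T {h h′ a a′ ι ι′ w w′} → column T h a ι w ≡ column T h′ a′ ι′ w′ →
                       w ≡ w′ × (h ≡ h′ → (∀ s → ι s ≡ ι′ s) → ∀ s → a s ≡ a′ s)
    column-injective zero eq = eq , λ _ _ ()
    column-injective (suc T) {h} {h′} {a} {a′} {ι} {ι′} eq
      with heads , tails ← Fin.combine-injective (lead (rowOf (suc T)) h (a zero) (ι zero)) _
                                                (lead (rowOf (suc T)) h′ (a′ zero) (ι′ zero)) _ eq
      with w≡ , rest ← column-injective T tails =
      w≡ , λ { refl ι≡ → λ
        { zero    → Fin.toℕ-injective (+-cancelʳ-≡ _ _ _ (trans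
                      (lead≡⇒coord≡ (rowOf (suc T)) h (a zero) (ι zero) h (a′ zero) (ι′ zero) heads)
                      (cong (coord (rowOf (suc T)) h (a′ zero)) (sym (ι≡ zero)))))
        ; (suc s) → rest refl (ι≡ ∘ suc) s } }

    -- Used with `p = T`: the last column in play at level `suc T`, column `3 + T`, lies in the row
    -- `rowOf (suc T)`.
    step-< : ∀ p (h : Fin 2 → Fin Q) → h 0F Fin.< h 1F →
             step (rowOf (suc p)) (h (rowOf (suc p))) < step (rowOf (suc p)) (h (rowOf p))
    step-< p h h₀<h₁ with rowOf p | rowOf (suc p) | rowOf-suc p
    ... | .1F | .0F | inj₁ (refl , refl) = s≤s h₀<h₁
    ... | .0F | .1F | inj₂ (refl , refl) = ∸-monoʳ-< h₀<h₁ (<⇒≤ (Fin.toℕ<n (h 1F)))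

    -- Each level forces all but the last of the remaining columns into the block of column 0.
    levels : ∀ T (h : Fin 2 → Fin Q) → h 0F Fin.< h 1F →
             (a : Fin 2 → Fin T → Fin A) (ι : ℕ → Fin T → Fin m) (w : ℕ → Fin W) →
             let X : ℕ → Fin (width T)
                 X p = column T (h (rowOf p)) (a (rowOf p)) (ι p) (w p) in
             column T (h 0F) (a 0F) (ι 0) (w 0) ≡ X 0 →
             (∀ {p} → p < 2 + T → X (suc p) Fin.< X p) →
             (∀ s → ι 1 s ≡ ι 0 s) × (∀ s → ι 2 s ≡ ι 0 s) × w 1 Fin.< w 0 × w 2 Fin.< w 1
    levels zero    h h₀<h₁ a ι w common dec = (λ ()) , (λ ()) , dec z<s , dec (s<s z<s)
    levels (suc T) h h₀<h₁ a ι w common dec =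
      (λ { zero → ι-flat {1} (s≤s z≤n) ; (suc s) → proj₁ IH s }) ,
      (λ { zero → ι-flat {2} (s≤s (s≤s z≤n)) ; (suc s) → proj₁ (proj₂ IH) s }) ,
      proj₂ (proj₂ IH)
      where
      lvl = rowOf (suc T)

      head : Fin 2 → Fin m → ℕ
      head i = coord lvl (h i) (a i zero)

      first : Fin 2 → ℕ → Fin (2 * A)
      first i p = lead lvl (h i) (a i zero) (ι p zero)

      toℕ-first : ∀ p → toℕ (first (rowOf p) p) ≡ head (rowOf p) (ι p zero)
      toℕ-first p = toℕ-lead lvl (h (rowOf p)) (a (rowOf p) zero) (ι p zero)

      y : ℕ → ℕ
      y p = head (rowOf p) (ι p zero)

      tail : ℕ → Fin (width T)
      tail p = column T (h (rowOf p)) (a (rowOf p) ∘ suc) (ι p ∘ suc) (w p)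

      heads-common : ∀ i → head i (ι 0 zero) ≡ y 0
      heads-common 0F = lead≡⇒coord≡ lvl (h 0F) (a 0F zero) (ι 0 zero) (h 1F) (a 1F zero) (ι 0 zero)
        (Fin.combine-injectiveˡ (first 0F 0) _ (first 1F 0) _ common)
      heads-common 1F = refl

      y-suc : ∀ {p} → p < 3 + T → y (suc p) ≤ y p
      y-suc {p} p< = subst₂ _≤_ (toℕ-first (suc p)) (toℕ-first p)
        (combine-<⇒≤ {i = first _ (suc p)} {first _ p} {tail (suc p)} {tail p} (dec p<))

      y-mono : ∀ {p q} → p ≤ q → q ≤ 3 + T → y q ≤ y p
      y-mono {q = zero}  z≤n _ = ≤-refl
      y-mono {q = suc q} p≤q q≤ with m≤n⇒m<n∨m≡n p≤q
      ... | inj₂ refl = ≤-refl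
      ... | inj₁ p<q  = ≤-trans (y-suc q≤) (y-mono (s≤s⁻¹ p<q) (<⇒≤ q≤))

      -- As `rowOf` has period 2, columns `2 + T` and `3 + T` lie in the rows `rowOf T` and `lvl`,
      -- the former with the larger step. Its head is at least that of column `3 + T` and at most
      -- that of column 0, which `same-scale` allows only in the scale of column 0.
      last-scale : toℕ (ι (2 + T) zero) ≡ toℕ (ι 0 zero)
      last-scale = same-scale {i₂ = toℕ (ι (3 + T) zero)} 2≤Q (step-< T h h₀<h₁)
        (step≤Q lvl (h (rowOf T))) (1≤step lvl (h lvl))
        (trans (heads-common (rowOf T)) (sym (heads-common lvl)))
        (y-suc {2 + T} ≤-refl)
        (≤-trans (y-mono {0} {2 + T} z≤n (n≤1+n _)) (≤-reflexive (sym (heads-common (rowOf T)))))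

      y-flat : ∀ {p} → p ≤ 2 + T → y p ≡ y 0
      -- The heads decrease weakly from column 0 to column `2 + T`, and these two agree.
      y-flat {p} p≤ = ≤-antisym (y-mono z≤n (m≤n⇒m≤1+n p≤)) (begin
        y 0                        ≡⟨ heads-common (rowOf T) ⟨
        head (rowOf T) (ι 0 zero)  ≡⟨ cong (head (rowOf T)) (Fin.toℕ-injective last-scale) ⟨
        y (2 + T)                  ≤⟨ y-mono p≤ (n≤1+n _) ⟩
        y p                        ∎)
        where open ≤-Reasoning

      ι-flat : ∀ {p} → p ≤ 2 + T → ι p zero ≡ ι 0 zero
      ι-flat {p} p≤ = Fin.toℕ-injective (scale-injective 2≤Q (1≤step lvl (h (rowOf p))) (toℕ (a (rowOf p) zero))
        (trans (y-flat p≤) (sym (heads-common (rowOf p)))))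

      tail-dec : ∀ {p} → p < 2 + T → tail (suc p) Fin.< tail p
      tail-dec {p} p< with combine-<⇒ {i = first _ (suc p)} {first _ p} {tail (suc p)} {tail p} (dec (m≤n⇒m≤1+n p<))
      ... | inj₂ (_ , t<) = t<
      ... | inj₁ y<  = contradiction (trans (y-flat p<) (sym (y-flat (<⇒≤ p<))))
                         (<⇒≢ (subst₂ _<_ (toℕ-first (suc p)) (toℕ-first p) y<))

      IH = levels T h h₀<h₁ (λ i → a i ∘ suc) (λ p → ι p ∘ suc) w
             (Fin.combine-injectiveʳ (first 0F 0) _ (first 1F 0) _ common) tail-dec

  funToFin-cong : ∀ {k l} {f g : Fin k → Fin l} → (∀ i → f i ≡ g i) → funToFin f ≡ funToFin g
  funToFin-cong {zero}  eq = refl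
  funToFin-cong {suc k} eq = cong₂ combine (eq zero) (funToFin-cong (eq ∘ suc))

  finToFun-injective : ∀ {k l} {x y : Fin (l ^ k)} → (∀ i → finToFun {l} {k} x i ≡ finToFun y i) → x ≡ y
  finToFun-injective {k} {l} {x} {y} eq = trans (sym (Fin.funToFin-finToFin {k} x))
    (trans (funToFin-cong eq) (Fin.funToFin-finToFin {k} y))

  opposite-cancel-< : ∀ {n} {i j : Fin n} → opposite i Fin.< opposite j → j Fin.< i
  opposite-cancel-< {n} {i} {j} lt = ≰⇒> λ i≤j → <⇒≱ lt
    (subst₂ _≤_ (sym (Fin.opposite-prop j)) (sym (Fin.opposite-prop i)) (∸-monoʳ-≤ n (s≤s i≤j)))

  opposite-injective : ∀ {n} {i j : Fin n} → opposite i ≡ opposite j → i ≡ j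
  opposite-injective {i = i} {j} eq = trans (sym (Fin.opposite-involutive i))
    (trans (cong opposite eq) (Fin.opposite-involutive j))

  rejoin : ∀ {k l} {x y : Fin (k * l)} → proj₁ (remQuot {k} l x) ≡ proj₁ (remQuot {k} l y) →
           proj₂ (remQuot {k} l x) ≡ proj₂ (remQuot {k} l y) → x ≡ y
  rejoin {k} {l} {x} {y} p q = trans (sym (Fin.combine-remQuot {k} l x))
    (trans (cong₂ combine p q) (Fin.combine-remQuot {k} l y))

  -- Matrices given by the entries of their rows, and copies of the pattern in them

  module Placement {R F m W n : ℕ} (entry : Fin R → Fin F → Fin m → Fin W) (R≤n : R ≤ n) (W≤n : W ≤ n) where

    rowIn : Fin R → Fin n
    rowIn r = inject≤ r R≤n

    -- Decreasing columns of the construction become increasing ones.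
    columnIn : Fin W → Fin n
    columnIn x = opposite (inject≤ x W≤n)

    columnIn-injective : ∀ {x y} → columnIn x ≡ columnIn y → x ≡ y
    columnIn-injective eq = Fin.inject≤-injective W≤n W≤n _ _ (opposite-injective eq)

    columnIn-cancel-< : ∀ {x y} → columnIn x Fin.< columnIn y → y Fin.< x
    columnIn-cancel-< {x} {y} lt = subst₂ _<_ (Fin.toℕ-inject≤ y W≤n) (Fin.toℕ-inject≤ x W≤n)
      (opposite-cancel-< {i = inject≤ x W≤n} {inject≤ y W≤n} lt)

    Edge : Fin n → Fin n → Set
    Edge i c = ∃ λ r → ∃ λ ι → ∃ λ j → rowIn r ≡ i × columnIn (entry r ι j) ≡ c

    edge? : ∀ i c → Dec (Edge i c)
    edge? i c = Fin.any? λ r → Fin.any? λ ι → Fin.any? λ j →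
      (rowIn r Fin.≟ i) ×-dec (columnIn (entry r ι j) Fin.≟ c)

    matrix : Matrix n n
    matrix i c = ⌊ edge? i c ⌋

    -- The columns 0, …, t + 1 of a copy of P_t, with t = T + 1, in reversed order; the row of
    -- column p ≥ 1 is r (rowOf p), and column 0 belongs to both rows.
    record Copy (T : ℕ) : Set where
      field
        r      : Fin 2 → Fin R
        ιs     : ℕ → Fin F
        js     : ℕ → Fin m
        ι₀     : Fin F
        j₀     : Fin m
        r₀<r₁  : r 0F Fin.< r 1F
        common : entry (r 0F) ι₀ j₀ ≡ entry (r 1F) (ιs 0) (js 0)
        dec    : ∀ {p} → p < 2 + T → entry (r (rowOf (suc p))) (ιs (suc p)) (js (suc p)) Fin.<
                                     entry (r (rowOf p)) (ιs p) (js p)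

    copy : ∀ T → matrix Contains alternating (suc T) → Copy T
    copy T (ρ , γ , ρ-inc , γ-inc , sound) = record
      { r = r ; ιs = ιs ; js = js ; ι₀ = _ ; j₀ = _ ; r₀<r₁ = r₀<r₁ ; common = first-common ; dec = X-dec }
      where
      2+T<t+2 : 2 + T < suc T + 2
      2+T<t+2 = ≤-reflexive (cong suc (+-comm 2 T))

      q : ∀ {p} → p ≤ 2 + T → Fin (suc T + 2)
      q p≤ = fromℕ< (≤-<-trans p≤ 2+T<t+2)

      toℕ-q : ∀ {p} (p≤ : p ≤ 2 + T) → toℕ (q p≤) ≡ p
      toℕ-q p≤ = Fin.toℕ-fromℕ< (≤-<-trans p≤ 2+T<t+2)

      first : ∀ i → Edge (ρ i) (γ (q z≤n))
      first i = witness (edge? _ _) (sound i (q z≤n) (alternating-zero (suc T) i (q z≤n) (toℕ-q z≤n)))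

      edgeAt : ∀ {p} (p≤ : p ≤ 2 + T) → Edge (ρ (rowOf p)) (γ (q p≤))
      edgeAt {p} p≤ = subst (λ k → Edge (ρ (rowOf k)) (γ (q p≤))) (toℕ-q p≤)
        (witness (edge? _ _) (sound _ (q p≤) (alternating-rowOf (suc T) (q p≤))))

      r : Fin 2 → Fin R
      r i = proj₁ (first i)

      At : ℕ → Fin F × Fin m → Set
      At p (ι , j) = ∀ (p≤ : p ≤ 2 + T) → columnIn (entry (r (rowOf p)) ι j) ≡ γ (q p≤)

      q-irrelevant : ∀ {p} (x y : p ≤ 2 + T) → q x ≡ q y
      q-irrelevant x y = Fin.toℕ-injective (trans (toℕ-q x) (sym (toℕ-q y)))

      at : ∀ p → ∃ (At p)
      at p with p ≤? 2 + T
      -- Beyond the last column of the pattern `At` is vacuous, and any default will do.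
      ... | no  p≰ = (proj₁ (proj₂ (first 0F)) , proj₁ (proj₂ (proj₂ (first 0F)))) , λ p≤ → contradiction p≤ p≰
      ... | yes p≤ with r′ , ι , j , row≡ , col≡ ← edgeAt p≤ =
        (ι , j) , λ p≤′ → trans (cong (λ x → columnIn (entry x ι j)) (sym r′≡)) (trans col≡ (cong γ (q-irrelevant p≤ p≤′)))
        where
        r′≡ : r′ ≡ r (rowOf p)
        r′≡ = Fin.inject≤-injective R≤n R≤n _ _ (trans row≡ (sym (proj₁ (proj₂ (proj₂ (proj₂ (first (rowOf p))))))))

      ιs : ℕ → Fin F
      ιs p = proj₁ (proj₁ (at p))

      js : ℕ → Fin m
      js p = proj₂ (proj₁ (at p))

      X : ℕ → Fin (W)
      X p = entry (r (rowOf p)) (ιs p) (js p)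

      -- As `rowOf 0` is `1F`, `X 0` is column 0 as reached from the lower row; the upper row
      -- reaches it through `first 0F`.
      first-common : entry (r 0F) _ _ ≡ X 0
      first-common = columnIn-injective
        (trans (proj₂ (proj₂ (proj₂ (proj₂ (first 0F))))) (sym (proj₂ (at 0) z≤n)))

      r₀<r₁ : r 0F Fin.< r 1F
      r₀<r₁ = subst₂ _<_ (row 0F) (row 1F) (ρ-inc {0F} {1F} z<s)
        where
        row : ∀ i → toℕ (ρ i) ≡ toℕ (r i)
        row i = trans (cong toℕ (sym (proj₁ (proj₂ (proj₂ (proj₂ (first i))))))) (Fin.toℕ-inject≤ (r i) R≤n)

      X-dec : ∀ {p} → p < 2 + T → X (suc p) Fin.< X p
      X-dec {p} p< = columnIn-cancel-< (subst₂ Fin._<_ (sym (proj₂ (at p) (<⇒≤ p<))) (sym (proj₂ (at (suc p)) p<))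
        (γ-inc (subst₂ _<_ (sym (toℕ-q (<⇒≤ p<))) (sym (toℕ-q p<)) ≤-refl)))

    matrix-ones : (∀ r {ι j ι′ j′} → entry r ι j ≡ entry r ι′ j′ → ι ≡ ι′ × j ≡ j′) →
                  R * (F * m) ≤ ones matrix
    matrix-ones entry-injective = begin
      R * (F * m)                              ≡⟨ sum-const R (F * m) ⟨
      sum {R} (λ _ → F * m)                    ≤⟨ sum-mono-≤ row ⟩
      sum (λ r → count (matrix (rowIn r)))     ≤⟨ sum-subset (λ i → count (matrix i)) rowIn
                                                    (Fin.inject≤-injective R≤n R≤n _ _) ⟩
      ones matrix                              ∎
      where
      open ≤-Reasoning
      place : Fin R → Fin (F * m) → Fin n
      place r k = columnIn (entry r (proj₁ (remQuot {F} m k)) (proj₂ (remQuot {F} m k)))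
      place-injective : ∀ r {k l} → place r k ≡ place r l → k ≡ l
      place-injective r {k} {l} eq with ι≡ , j≡ ← entry-injective r (columnIn-injective eq) = rejoin {F} ι≡ j≡
      row : ∀ r → F * m ≤ count (matrix (rowIn r))
      row r = begin
        F * m                                              ≡⟨ *-identityʳ (F * m) ⟨
        F * m * 1                                          ≡⟨ sum-const (F * m) 1 ⟨
        sum {F * m} (λ _ → 1)                              ≤⟨ sum-mono-≤ (λ k → ≤-reflexive (sym
                                                                (⟦⌊⌋⟧-yes (edge? (rowIn r) (place r k)) (r , _ , _ , refl , refl)))) ⟩
        sum (λ k → ⟦ matrix (rowIn r) (place r k) ⟧)       ≤⟨ sum-subset (λ c → ⟦ matrix (rowIn r) c ⟧) (place r) (place-injective r) ⟩
        count (matrix (rowIn r))                           ∎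

  -- P_t-free matrices for t = T + 1.  A row is (h, f, z, a) with h < Q, f < F, z < Z and a_s < Q^m for
  -- s < T.  A choice of ι ∈ [m]^T, coded by a number below F, and of j < m leads to the column
  -- (a_s + v_s Q^ι_s)_s, z + β b^j, h + (j b + β), ι, where v_s is a step of level s and β = 1 + f + ι.
  -- Rows and columns are ordered lexicographically, but h is the first component of a row.
  module Construction (T m Z : ℕ) .{{_ : NonZero m}} where

    F = m ^ T
    b = 2 * F
    Q = m * b

    1≤F : 1 ≤ F
    1≤F = m^n>0 m T

    2≤b : 2 ≤ b
    2≤b = *-monoʳ-≤ 2 1≤F

    2≤Q : 2 ≤ Q
    2≤Q = ≤-trans 2≤b (m≤n*m b m)

    W = 2 * Z * (2 * Q * F)

    open Levels m Q W 2≤Q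

    -- The step β is determined by the row label f and the block ι, and determines f from ι.
    β : Fin F → Fin F → ℕ
    β f ι = suc (toℕ f + toℕ ι)

    β<b : ∀ f ι → β f ι < b
    β<b f ι = begin
      suc (suc (toℕ f + toℕ ι))   ≡⟨ cong suc (+-suc (toℕ f) (toℕ ι)) ⟨
      suc (toℕ f) + suc (toℕ ι)   ≤⟨ +-mono-≤ (Fin.toℕ<n f) (Fin.toℕ<n ι) ⟩
      F + F                       ≡⟨ cong (F +_) (+-identityʳ F) ⟨
      b                           ∎
      where open ≤-Reasoning

    -- As `β < b`, the numerical order of shifts is the lexicographic order of the pairs of `j` and
    -- `β`.
    shift : Fin F → Fin F → Fin m → ℕ
    shift f ι j = toℕ j * b + β f ι

    shift< : ∀ f ι j → shift f ι j < Q
    shift< f ι j = begin-strict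
      toℕ j * b + β f ι  <⟨ +-monoʳ-< (toℕ j * b) (β<b f ι) ⟩
      toℕ j * b + b      ≡⟨ +-comm (toℕ j * b) b ⟩
      suc (toℕ j) * b    ≤⟨ *-monoˡ-≤ b (Fin.toℕ<n j) ⟩
      m * b              ∎
      where open ≤-Reasoning

    zcoord : Fin F → Fin Z → Fin F → Fin m → ℕ
    zcoord f z ι j = toℕ z + β f ι * b ^ toℕ j

    hcoord : Fin Q → Fin F → Fin F → Fin m → ℕ
    hcoord h f ι j = toℕ h + shift f ι j

    <2* : ∀ {k l x y} → x < k → y < k → k ≡ l → x + y < 2 * l
    <2* {k} x<k y<k refl = ≤-trans (+-mono-< x<k y<k) (≤-reflexive (cong (k +_) (sym (+-identityʳ k))))

    hcoord< : ∀ h f ι j → hcoord h f ι j < 2 * Q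
    hcoord< h f ι j = <2* (Fin.toℕ<n h) (shift< f ι j) refl

    module _ (b^m≤Z : b ^ m ≤ Z) where

      instance
        b≢0 : NonZero b
        b≢0 = >-nonZero (≤-trans (s≤s z≤n) 2≤b)

      zcoord< : ∀ f z ι j → zcoord f z ι j < 2 * Z
      zcoord< f z ι j = <2* (Fin.toℕ<n z) (begin-strict
        β f ι * b ^ toℕ j  <⟨ *-monoˡ-< (b ^ toℕ j) {{m^n≢0 b (toℕ j)}} (β<b f ι) ⟩
        b ^ suc (toℕ j)    ≤⟨ ^-monoʳ-≤ b (Fin.toℕ<n j) ⟩
        b ^ m              ≤⟨ b^m≤Z ⟩
        Z                  ∎) refl
        where open ≤-Reasoning

      Label = Fin Q × Fin F × Fin Z

      zval hval : Label → Fin F → Fin m → ℕ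
      zval (_ , f , z) = zcoord f z
      hval (h , f , _) = hcoord h f

      zFin : Label → Fin F → Fin m → Fin (2 * Z)
      zFin (_ , f , z) ι j = fromℕ< (zcoord< f z ι j)

      hFin : Label → Fin F → Fin m → Fin (2 * Q)
      hFin (h , f , _) ι j = fromℕ< (hcoord< h f ι j)

      bottom : Label → Fin F → Fin m → Fin W
      bottom x ι j = combine (zFin x ι j) (combine (hFin x ι j) ι)

      bottom-injective : ∀ x ι j x′ ι′ j′ → bottom x ι j ≡ bottom x′ ι′ j′ →
                         zval x ι j ≡ zval x′ ι′ j′ × hval x ι j ≡ hval x′ ι′ j′ × ι ≡ ι′
      bottom-injective x@(h , f , z) ι j x′@(h′ , f′ , z′) ι′ j′ eq
        with eq₁ , eq₂ ← Fin.combine-injective (zFin x ι j) (combine (hFin x ι j) ι)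
                                               (zFin x′ ι′ j′) (combine (hFin x′ ι′ j′) ι′) eq
        with eq₃ , ι≡ ← Fin.combine-injective (hFin x ι j) ι (hFin x′ ι′ j′) ι′ eq₂ =
        Fin.fromℕ<-injective _ _ (zcoord< f z ι j) (zcoord< f′ z′ ι′ j′) eq₁ ,
        Fin.fromℕ<-injective _ _ (hcoord< h f ι j) (hcoord< h′ f′ ι′ j′) eq₃ , ι≡

      bottom-<⇒ : ∀ x ι j x′ ι′ j′ → bottom x ι j Fin.< bottom x′ ι′ j′ → zval x ι j ≤ zval x′ ι′ j′
      bottom-<⇒ x@(_ , f , z) ι j x′@(_ , f′ , z′) ι′ j′ lt =
        subst₂ _≤_ (Fin.toℕ-fromℕ< (zcoord< f z ι j)) (Fin.toℕ-fromℕ< (zcoord< f′ z′ ι′ j′))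
          (combine-<⇒≤ {i = zFin x ι j} {zFin x′ ι′ j′} {combine (hFin x ι j) ι} {combine (hFin x′ ι′ j′) ι′} lt)

      -- In the common column the h-coordinates agree, so the row with the smaller `h` has the
      -- larger shift. By `drop-scale` its z-coordinate in the smaller scale `j₁` is then at most
      -- `z′`, but all columns of the other row lie beyond `z′`.
      bottom-clash : ∀ x x′ ι {j₀ j₀′ j₁ j₂} → proj₁ x Fin.< proj₁ x′ →
                     bottom x ι j₀ ≡ bottom x′ ι j₀′ →
                     bottom x ι j₁ Fin.< bottom x ι j₀ →
                     ¬ bottom x′ ι j₂ Fin.< bottom x ι j₁
      bottom-clash x@(h , f , z) x′@(h′ , f′ , z′) ι {j₀} {j₀′} {j₁} {j₂} h<h′ common w₁<w₀ w₂<w₁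
        with z≡ , h≡ , _ ← bottom-injective x ι j₀ x′ ι j₀′ common =
        <⇒≱ (≤-<-trans z₁≤z′ (m<m+n (toℕ z′) (*-mono-≤ {1} {β f′ ι} (s≤s z≤n) (m^n>0 b (toℕ j₂)))))
          (bottom-<⇒ x′ ι j₂ x ι j₁ w₂<w₁)
        where
        open ≤-Reasoning
        shift′<shift : shift f′ ι j₀′ < shift f ι j₀
        shift′<shift = ≰⇒> λ le → <⇒≢ (+-mono-<-≤ h<h′ le) h≡
        j₁<j₀ : toℕ j₁ < toℕ j₀
        j₁<j₀ with <-cmp (toℕ j₁) (toℕ j₀)
        ... | tri< lt _ _ = lt
        ... | tri≈ _ eq _ with refl ← Fin.toℕ-injective eq = contradiction w₁<w₀ (<-irrefl refl)
        ... | tri> _ _ gt = contradiction (bottom-<⇒ x ι j₁ x ι j₀ w₁<w₀)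
          (<⇒≱ (+-monoʳ-< (toℕ z) (*-monoʳ-< (β f ι) (^-monoʳ-< b 2≤b gt))))
        z₁≤z′ : zcoord f z ι j₁ ≤ toℕ z′
        z₁≤z′ = +-cancelʳ-≤ (β f′ ι * b ^ toℕ j₀′) _ _ (begin
          toℕ z + β f ι * b ^ toℕ j₁ + β f′ ι * b ^ toℕ j₀′    ≡⟨ +-assoc (toℕ z) _ _ ⟩
          toℕ z + (β f ι * b ^ toℕ j₁ + β f′ ι * b ^ toℕ j₀′)  ≡⟨ cong (toℕ z +_) (+-comm (β f ι * b ^ toℕ j₁) _) ⟩
          toℕ z + (β f′ ι * b ^ toℕ j₀′ + β f ι * b ^ toℕ j₁)  ≤⟨ +-monoʳ-≤ (toℕ z)
            (drop-scale {b} {toℕ j₀} {toℕ j₀′} {β f ι} {β f′ ι} shift′<shift (β<b f ι) (β<b f′ ι) (s≤s z≤n) j₁<j₀) ⟩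
          zcoord f z ι j₀                                      ≡⟨ z≡ ⟩
          zcoord f′ z′ ι j₀′                                   ∎)

      R = Q * (F * (Z * A ^ T))

      hOf : Fin R → Fin Q
      hOf r = proj₁ (remQuot (F * (Z * A ^ T)) r)

      restOf : Fin R → Fin (F * (Z * A ^ T))
      restOf r = proj₂ (remQuot {Q} (F * (Z * A ^ T)) r)

      fOf : Fin R → Fin F
      fOf r = proj₁ (remQuot (Z * A ^ T) (restOf r))

      rest₂Of : Fin R → Fin (Z * A ^ T)
      rest₂Of r = proj₂ (remQuot {F} (Z * A ^ T) (restOf r))

      zOf : Fin R → Fin Z
      zOf r = proj₁ (remQuot (A ^ T) (rest₂Of r))

      aCode : Fin R → Fin (A ^ T)
      aCode r = proj₂ (remQuot {Z} (A ^ T) (rest₂Of r))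

      aOf : Fin R → Fin T → Fin A
      aOf r = finToFun (aCode r)

      row-injective : ∀ {r r′} → hOf r ≡ hOf r′ → fOf r ≡ fOf r′ → zOf r ≡ zOf r′ →
                      (∀ s → aOf r s ≡ aOf r′ s) → r ≡ r′
      row-injective {r} {r′} h≡ f≡ z≡ a≡ =
        rejoin {Q} h≡ (rejoin {F} f≡ (rejoin {Z} z≡ (finToFun-injective {T} a≡)))

      hOf-mono : ∀ {r r′} → r Fin.< r′ → hOf r Fin.≤ hOf r′
      hOf-mono {r} {r′} r<r′ = combine-<⇒≤ {i = hOf r} {hOf r′} {restOf r} {restOf r′}
        (subst₂ Fin._<_ (sym (Fin.combine-remQuot {Q} _ r)) (sym (Fin.combine-remQuot {Q} _ r′)) r<r′)

      label : Fin R → Label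
      label r = hOf r , fOf r , zOf r

      entry : Fin R → Fin F → Fin m → Fin (width T)
      entry r ι j = column T (hOf r) (aOf r) (finToFun ι) (bottom (label r) ι j)

      entry-injective : ∀ r {ι j ι′ j′} → entry r ι j ≡ entry r ι′ j′ → ι ≡ ι′ × j ≡ j′
      entry-injective r {ι} {j} {ι′} {j′} eq
        with z≡ , _ , refl ← bottom-injective (label r) ι j (label r) ι′ j′ (proj₁ (column-injective T eq)) =
        refl , Fin.toℕ-injective (scale-injective {b} {β (fOf r) ι} 2≤b (s≤s z≤n) (toℕ (zOf r)) z≡)

      -- With `h` cancelled, the shift determines `j` and `β`; `β` and `ι` determine `f`, the
      -- z-coordinate then `z`, and `column-injective` the offsets. So distinct rows that meet in a
      -- column differ in `h`.
      common-entry : ∀ r r′ {ι j ι′ j′} → entry r ι j ≡ entry r′ ι′ j′ → hOf r ≡ hOf r′ → r ≡ r′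
      common-entry r r′ {ι} {j} {ι′} {j′} eq h≡
        with w≡ , a≡ ← column-injective T eq
        with z≡ , hc≡ , refl ← bottom-injective (label r) ι j (label r′) ι′ j′ w≡
        with j≡ , β≡ ← lex-injective {b} {toℕ j} {toℕ j′} {β (fOf r) ι} {β (fOf r′) ι} (s≤s z≤n) (β<b (fOf r) ι)
               (+-cancelˡ-≡ (toℕ (hOf r)) _ _ (trans hc≡ (cong (λ x → toℕ x + shift (fOf r′) ι j′) (sym h≡))))
               (β<b (fOf r′) ι) (s≤s z≤n)
        with refl ← Fin.toℕ-injective j≡ =
        row-injective {r} {r′} h≡ f≡ z′≡ (a≡ h≡ (λ _ → refl))
        where
        f≡ : fOf r ≡ fOf r′
        f≡ = Fin.toℕ-injective (+-cancelʳ-≡ (toℕ ι) _ _ (suc-injective β≡))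
        z′≡ : zOf r ≡ zOf r′
        z′≡ = Fin.toℕ-injective (+-cancelʳ-≡ (β (fOf r) ι * b ^ toℕ j) _ _
          (trans z≡ (cong (λ x → toℕ (zOf r′) + x * b ^ toℕ j) (sym β≡))))

      module _ {n : ℕ} (R≤n : R ≤ n) (w≤n : width T ≤ n) where

        open Placement entry R≤n w≤n

        -- `levels` leaves columns 0, 1 and 2 with a common `ι`. Column 1 is in the upper row and
        -- column 2 in the lower one, as excluded by `bottom-clash`.
        no-copy : ¬ Copy T
        no-copy c =
          bottom-clash (label (r 0F)) (label (r 1F)) (ιs 0) {j₀} {js 0} {js 1} {js 2} h<h′
            (proj₁ common′)
            (subst₂ (λ ι w → bottom (label (r 0F)) ι (js 1) Fin.< w) ι₁≡ (sym (proj₁ common′)) (proj₁ (proj₂ (proj₂ conclusion))))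
            (subst₂ (λ ι ι′ → bottom (label (r 1F)) ι (js 2) Fin.< bottom (label (r 0F)) ι′ (js 1)) ι₂≡ ι₁≡
              (proj₂ (proj₂ (proj₂ conclusion))))
          where
          open Copy c

          w : ℕ → Fin W
          w p = bottom (label (r (rowOf p))) (ιs p) (js p)

          -- Columns record `ι`, so the upper row reaches column 0 with the same `ιs 0` and `w 0`,
          -- as `levels` expects.
          common′ : bottom (label (r 0F)) (ιs 0) j₀ ≡ w 0 ×
                    column T (hOf (r 0F)) (aOf (r 0F)) (finToFun (ιs 0)) (w 0) ≡ entry (r 1F) (ιs 0) (js 0)
          common′ with w≡ , _ ← column-injective T common
            with _ , _ , ι≡ ← bottom-injective (label (r 0F)) ι₀ j₀ (label (r 1F)) (ιs 0) (js 0) w≡ =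
            subst (λ ι → bottom (label (r 0F)) ι j₀ ≡ w 0) ι≡ w≡ ,
            subst₂ (λ ι w → column T (hOf (r 0F)) (aOf (r 0F)) (finToFun ι) w ≡ entry (r 1F) (ιs 0) (js 0)) ι≡ w≡ common

          -- Rows are ordered by `h` first, and by `common-entry` equal `h` would make the two rows
          -- equal.
          h<h′ : hOf (r 0F) Fin.< hOf (r 1F)
          h<h′ = Fin.≤∧≢⇒< (hOf-mono r₀<r₁) λ h≡ →
            Fin.<⇒≢ r₀<r₁ (common-entry (r 0F) (r 1F) {ι₀} {j₀} {ιs 0} {js 0} common h≡)

          conclusion = levels T (λ i → hOf (r i)) h<h′ (λ i → aOf (r i)) (λ p → finToFun (ιs p)) w (proj₂ common′) dec

          ι₁≡ : ιs 1 ≡ ιs 0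
          ι₁≡ = finToFun-injective {T} (proj₁ conclusion)

          ι₂≡ : ιs 2 ≡ ιs 0
          ι₂≡ = finToFun-injective {T} (proj₁ (proj₂ conclusion))

        Ex-lower : R * (F * m) ≤ Ex (alternating (suc T)) n
        Ex-lower = ≤-trans (matrix-ones entry-injective)
          (ones≤Ex (alternating (suc T)) matrix (λ contains → no-copy (copy T contains)))

  -- Choosing `m` and `Z`

  width≡ : ∀ {m Q W} (2≤Q : 2 ≤ Q) T → Levels.width m Q W 2≤Q T ≡ 2 ^ T * (Q ^ m) ^ T * W
  width≡ {W = W} 2≤Q zero = sym (+-identityʳ W)
  width≡ {m} {Q} {W} 2≤Q (suc T) = trans (cong (2 * Q ^ m *_) (width≡ {m} 2≤Q T)) (shuffle (Q ^ m) (2 ^ T) ((Q ^ m) ^ T) W)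
    where
    shuffle : ∀ a x y w → 2 * a * (x * y * w) ≡ 2 * x * (a * y) * w
    shuffle = solve-∀

  module _ (T : ℕ) where

    private
      t = suc T
      K = (3 + T) * (3 + T)

    instance
      K≢0 : NonZero K
      K≢0 = _

    -- The range of Z absorbs what the other ranges, of O(m v) bits together, leave of n.
    Ex-lower-bits : ∀ {n l v m} .{{_ : NonZero m}} → 2 ^ l ≤ n → m ≤ 2 ^ v → 1 ≤ v → m * (K * v) ≤ l →
                    n * (m ^ t) ≤ 2 ^ (3 + T) * Ex (alternating t) n
    Ex-lower-bits {n} {l} {v} {m} 2^l≤n m≤2^v 1≤v mKv≤l = begin
      n * m ^ t                          ≤⟨ *-monoˡ-≤ (m ^ t) n≤R ⟩
      2 ^ (3 + T) * R b^m≤Z * m ^ t      ≡⟨ *-assoc (2 ^ (3 + T)) (R b^m≤Z) (m ^ t) ⟩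
      2 ^ (3 + T) * (R b^m≤Z * m ^ t)    ≡⟨ cong (λ x → 2 ^ (3 + T) * (R b^m≤Z * x)) (*-comm m (m ^ T)) ⟩
      2 ^ (3 + T) * (R b^m≤Z * (m ^ T * m)) ≤⟨ *-monoʳ-≤ (2 ^ (3 + T)) (Ex-lower b^m≤Z R≤n width≤n) ⟩
      2 ^ (3 + T) * Ex (alternating t) n ∎
      where
      open ≤-Reasoning
      -- The width of the construction without its factor `Z`.
      S = 2 ^ T * ((m * (2 * m ^ T)) ^ m) ^ T * (2 * (2 * (m * (2 * m ^ T)) * m ^ T))
      F≤ : m ^ T ≤ 2 ^ (v * T)
      F≤ = ≤-trans (^-monoˡ-≤ T m≤2^v) (≤-reflexive (^-*-assoc 2 v T))
      b≤ : 2 * m ^ T ≤ 2 ^ (v * t)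
      b≤ = begin
        2 * m ^ T           ≤⟨ *-monoʳ-≤ 2 F≤ ⟩
        2 ^ (1 + v * T)     ≤⟨ ^-monoʳ-≤ 2 (+-monoˡ-≤ (v * T) 1≤v) ⟩
        2 ^ (v + v * T)     ≡⟨ cong (2 ^_) (*-suc v T) ⟨
        2 ^ (v * t)         ∎
      Q≤ : m * (2 * m ^ T) ≤ 2 ^ (v * suc t)
      Q≤ = begin
        m * (2 * m ^ T)       ≤⟨ *-mono-≤ m≤2^v b≤ ⟩
        2 ^ v * 2 ^ (v * t)   ≡⟨ ^-distribˡ-+-* 2 v (v * t) ⟨
        2 ^ (v + v * t)       ≡⟨ cong (2 ^_) (*-suc v t) ⟨
        2 ^ (v * suc t)       ∎
      power : ∀ {x} e k → x ≤ 2 ^ e → x ^ k ≤ 2 ^ (e * k)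
      power e k x≤ = ≤-trans (^-monoˡ-≤ k x≤) (≤-reflexive (^-*-assoc 2 e k))
      times : ∀ {x y} d e → x ≤ 2 ^ d → y ≤ 2 ^ e → x * y ≤ 2 ^ (d + e)
      times d e x≤ y≤ = ≤-trans (*-mono-≤ x≤ y≤) (≤-reflexive (sym (^-distribˡ-+-* 2 d e)))
      v≤vm : v ≤ v * m
      v≤vm = m≤m*n v m
      exponent : T + v * suc t * m * T + (1 + ((1 + v * suc t) + v * T)) + v * t * m ≤ l
      exponent = begin
        T + v * suc t * m * T + (1 + ((1 + v * suc t) + v * T)) + v * t * m
          ≤⟨ +-monoˡ-≤ (v * t * m) (+-mono-≤ (+-monoˡ-≤ (v * suc t * m * T) (m≤m*n T (v * m) {{vm≢0}}))
               (+-mono-≤ 1≤vm (+-mono-≤ (+-mono-≤ 1≤vm (*-monoˡ-≤ (suc t) v≤vm)) (*-monoˡ-≤ T v≤vm)))) ⟩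
        T * (v * m) + v * suc t * m * T + (v * m + ((v * m + v * m * suc t) + v * m * T)) + v * t * m
          -- The coefficient of `v * m` so far is `T * T + 6 * T + 5`; adding 4 completes it to
          -- `(3 + T) * (3 + T)`.
          ≤⟨ m≤m+n _ (v * m * 4) ⟩
        T * (v * m) + v * suc t * m * T + (v * m + ((v * m + v * m * suc t) + v * m * T)) + v * t * m + v * m * 4
          ≡⟨ total T v m ⟩
        m * (K * v)
          ≤⟨ mKv≤l ⟩
        l ∎
        where
        1≤vm : 1 ≤ v * m
        1≤vm = ≤-trans 1≤v v≤vm
        vm≢0 : NonZero (v * m)
        vm≢0 = >-nonZero 1≤vm
        total : ∀ T v m → T * (v * m) + v * (2 + T) * m * T + (v * m + ((v * m + v * m * (2 + T)) + v * m * T))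
                              + v * (1 + T) * m + v * m * 4
                          ≡ m * ((3 + T) * (3 + T) * v)
        total = solve-∀
      Sb^m≤n : S * (2 * m ^ T) ^ m ≤ n
      Sb^m≤n = ≤-trans
        (times (T + v * suc t * m * T + (1 + ((1 + v * suc t) + v * T))) (v * t * m)
          (times (T + v * suc t * m * T) (1 + ((1 + v * suc t) + v * T))
            (times T (v * suc t * m * T) ≤-refl (power (v * suc t * m) T (power (v * suc t) m Q≤)))
            (times 1 ((1 + v * suc t) + v * T) ≤-refl
              (times (1 + v * suc t) (v * T) (times 1 (v * suc t) ≤-refl Q≤) F≤)))
          (power (v * t) m b≤))
        (≤-trans (^-monoʳ-≤ 2 exponent) 2^l≤n)
      S≢0 : NonZero S
      S≢0 = m*n≢0 _ _ {{m*n≢0 (2 ^ T) _ {{m^n≢0 2 T}} {{m^n≢0 _ T {{m^n≢0 _ m {{Q≢0}}}}}}}}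
                      {{m*n≢0 2 _ {{_}} {{m*n≢0 (2 * (m * (2 * m ^ T))) (m ^ T) {{m*n≢0 2 _ {{_}} {{Q≢0}}}} {{F≢0}}}}}}
        where
        F≢0 : NonZero (m ^ T)
        F≢0 = m^n≢0 m T
        Q≢0 : NonZero (m * (2 * m ^ T))
        Q≢0 = m*n≢0 m _ {{it}} {{m*n≢0 2 _ {{_}} {{F≢0}}}}
          where
          it : NonZero m
          it = >-nonZero (>-nonZero⁻¹ m)
      Z = _/_ n S {{S≢0}}
      open Construction T m Z using (R; Ex-lower)
      b^m≤Z : (2 * m ^ T) ^ m ≤ Z
      b^m≤Z = m*n≤o⇒m≤o/n _ Sb^m≤n
        where
        m*n≤o⇒m≤o/n : ∀ x → S * x ≤ n → x ≤ Z
        m*n≤o⇒m≤o/n x le = ≤-trans (≤-reflexive (sym (m*n/n≡m x S {{S≢0}})))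
          (/-monoˡ-≤ S {{S≢0}} (≤-trans (≤-reflexive (*-comm x S)) le))
      width = Levels.width m (m * (2 * m ^ T)) (2 * Z * (2 * (m * (2 * m ^ T)) * m ^ T)) (Construction.2≤Q T m Z) T
      width≡SZ : width ≡ Z * S
      width≡SZ = trans (width≡ {m} (Construction.2≤Q T m Z) T) (shuffle (2 ^ T * ((m * (2 * m ^ T)) ^ m) ^ T) Z (2 * (m * (2 * m ^ T)) * m ^ T))
        where
        shuffle : ∀ x z y → x * (2 * z * y) ≡ z * (x * (2 * y))
        shuffle = solve-∀
      width≤n : width ≤ n
      width≤n = ≤-trans (≤-reflexive width≡SZ) (m/n*n≤m n S {{S≢0}})
      -- Compared with rows, columns have `ι` in place of `f`, with the same range, and twice the
      -- range in each of the `T + 2` numerical coordinates.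
      ZS≡R : Z * S ≡ 2 ^ (2 + T) * R b^m≤Z
      ZS≡R = shuffle Z (2 ^ T) (((m * (2 * m ^ T)) ^ m) ^ T) (m * (2 * m ^ T)) (m ^ T)
        where
        shuffle : ∀ z p a q f → z * (p * a * (2 * (2 * q * f))) ≡ 2 * (2 * p) * (q * (f * (z * a)))
        shuffle = solve-∀
      R≤n : R b^m≤Z ≤ n
      R≤n = ≤-trans (m≤n*m (R b^m≤Z) (2 ^ (2 + T)) {{m^n≢0 2 (2 + T)}}) (≤-trans (≤-reflexive (trans (sym ZS≡R) (sym width≡SZ))) width≤n)
      n≤R : n ≤ 2 ^ (3 + T) * R b^m≤Z
      n≤R = begin
        n                            ≤⟨ <⇒≤ (m<suc[m/n]*n n S {{S≢0}}) ⟩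
        -- Since `Z` is at least 1, rounding `n / S` down costs at most a factor 2.
        suc Z * S                    ≤⟨ *-monoˡ-≤ S (+-monoˡ-≤ Z (≤-trans (m^n>0 (2 * m ^ T) {{m*n≢0 2 _ {{_}} {{m^n≢0 m T}}}} m) b^m≤Z)) ⟩
        (Z + Z) * S                  ≡⟨ twice Z S ⟩
        2 * (Z * S)                  ≡⟨ cong (2 *_) ZS≡R ⟩
        2 * (2 ^ (2 + T) * R b^m≤Z)  ≡⟨ *-assoc 2 (2 ^ (2 + T)) _ ⟨
        2 ^ (3 + T) * R b^m≤Z        ∎
        where
        twice : ∀ z s → (z + z) * s ≡ 2 * (z * s)
        twice = solve-∀

    Ex-lower-log : ∃ λ C → ∀ {n l v} → 2 ^ l ≤ n → l < 2 ^ suc v → 1 ≤ v → K * v ≤ l →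
                   n * l ^ t ≤ C * (Ex (alternating t) n * v ^ t)
    Ex-lower-log = 2 ^ (3 + T) * (2 * K) ^ t , bound
      where
      bound : ∀ {n l v} → 2 ^ l ≤ n → l < 2 ^ suc v → 1 ≤ v → K * v ≤ l →
              n * l ^ t ≤ 2 ^ (3 + T) * (2 * K) ^ t * (Ex (alternating t) n * v ^ t)
      bound {n} {l} {v} 2^l≤n l< 1≤v Kv≤l = begin
        n * l ^ t                                ≤⟨ *-monoʳ-≤ n (^-monoˡ-≤ t l≤) ⟩
        n * (2 * K * v * m) ^ t                  ≡⟨ cong (n *_) (trans (^-distribʳ-* t (2 * K * v) m) (cong (_* m ^ t) (^-distribʳ-* t (2 * K) v))) ⟩
        n * ((2 * K) ^ t * v ^ t * m ^ t)        ≡⟨ shuffle n ((2 * K) ^ t) (v ^ t) (m ^ t) ⟩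
        (2 * K) ^ t * v ^ t * (n * m ^ t)        ≤⟨ *-monoʳ-≤ ((2 * K) ^ t * v ^ t) (Ex-lower-bits 2^l≤n m≤2^v 1≤v (m/n*n≤m l (K * v))) ⟩
        (2 * K) ^ t * v ^ t * (2 ^ (3 + T) * E)  ≡⟨ shuffle′ ((2 * K) ^ t) (v ^ t) (2 ^ (3 + T)) E ⟩
        2 ^ (3 + T) * (2 * K) ^ t * (E * v ^ t)  ∎
        where
        open ≤-Reasoning
        E = Ex (alternating t) n
        instance
          Kv≢0 : NonZero (K * v)
          Kv≢0 = m*n≢0 K v {{_}} {{>-nonZero 1≤v}}
        -- The largest `m` that `Ex-lower-bits` admits; rounding down turns `K` into `2 * K` in the
        -- constant.
        m = l / (K * v)
        instance
          m≢0 : NonZero m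
          m≢0 = >-nonZero (m≥n⇒m/n>0 Kv≤l)
        shuffle : ∀ n a b c → n * (a * b * c) ≡ a * b * (n * c)
        shuffle = solve-∀
        shuffle′ : ∀ a b c e → a * b * (c * e) ≡ c * a * (e * b)
        shuffle′ = solve-∀
        double : ∀ m k v → (m + m) * (k * v) ≡ 2 * k * v * m
        double = solve-∀
        l≤ : l ≤ 2 * K * v * m
        l≤ = begin
          l                   ≤⟨ <⇒≤ (m<suc[m/n]*n l (K * v)) ⟩
          suc m * (K * v)     ≤⟨ *-monoˡ-≤ (K * v) (+-monoˡ-≤ m (>-nonZero⁻¹ m)) ⟩
          (m + m) * (K * v)   ≡⟨ double m K v ⟩
          2 * K * v * m       ∎
        m≤2^v : m ≤ 2 ^ v
        m≤2^v = *-cancelˡ-≤ 2 (begin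
          2 * m           ≡⟨ *-comm 2 m ⟩
          m * 2           ≤⟨ *-monoʳ-≤ m (*-mono-≤ {2} {K} (s≤s (s≤s z≤n)) 1≤v) ⟩
          m * (K * v)     ≤⟨ m/n*n≤m l (K * v) ⟩
          l               ≤⟨ <⇒≤ l< ⟩
          2 * 2 ^ v       ∎)

-- Dedekind cuts of `log n / log log n`

module Cuts where

  open import Data.Integer.Base as ℤ using (+_; -[1+_])
  import Data.Integer.Properties as ℤ
  open import Data.Nat.Base as ℕ using (ℕ; zero; suc)
  import Data.Nat.Properties as ℕ
  import Data.Nat.Coprimality as Coprimality
  open import Data.Product.Base
  open import Data.Rational.Base
  open import Data.Rational.Properties
  open import Data.Rational.Solver using (module +-*-Solver)
  open import Algebra.Bundles using (CommutativeRing)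
  open import Algebra.Properties.Semiring.Exp (CommutativeRing.semiring +-*-commutativeRing) using (_^_)
  open import Relation.Binary.PropositionalEquality hiding ([_])
  open import Relation.Nullary

  open +-*-Solver using (solve; _:*_; _:=_; con)

  ι : ℕ → ℚ
  ι n = + n / 1

  -- For a variable `n`, `+ n / 1` is blocked on a gcd. In this normal form the numerator and
  -- denominator are visible, which reduces order and products to integers.
  mk : ℕ → ℚ
  mk n = mkℚ (+ n) 0 (Coprimality.sym (Coprimality.1-coprimeTo n))

  ι≡mk : ∀ n → ι n ≡ mk n
  ι≡mk n = normalize-coprime (Coprimality.sym (Coprimality.1-coprimeTo n))

  ι-mono-≤ : ∀ {m n} → m ℕ.≤ n → ι m ≤ ι n
  ι-mono-≤ {m} {n} m≤n rewrite ι≡mk m | ι≡mk n = *≤* (ℤ.*-monoʳ-≤-nonNeg (+ 1) (ℤ.+≤+ m≤n))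

  ι-cancel-≤ : ∀ {m n} → ι m ≤ ι n → m ℕ.≤ n
  ι-cancel-≤ {m} {n} m≤n rewrite ι≡mk m | ι≡mk n = ℤ.drop‿+≤+ (ℤ.*-cancelʳ-≤-pos (+ m) (+ n) (+ 1) (drop-*≤* m≤n))

  ι-mono-< : ∀ {m n} → m ℕ.< n → ι m < ι n
  ι-mono-< m<n = ≰⇒> λ n≤m → ℕ.<⇒≱ m<n (ι-cancel-≤ n≤m)

  ι-* : ∀ m n → ι (m ℕ.* n) ≡ ι m * ι n
  ι-* m n rewrite ι≡mk m | ι≡mk n = cong (_/ 1) (ℤ.pos-* m n)

  ι-^ : ∀ m k → ι (m ℕ.^ k) ≡ ι m ^ k
  ι-^ m zero    = refl
  ι-^ m (suc k) = trans (ι-* m (m ℕ.^ k)) (cong (ι m *_) (ι-^ m k))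

  0≤ι : ∀ n → 0ℚ ≤ ι n
  0≤ι n = ι-mono-≤ {0} {n} ℕ.z≤n

  *-mono-≤-nonNeg : ∀ {a b c d} → 0ℚ ≤ c → 0ℚ ≤ b → a ≤ b → c ≤ d → a * c ≤ b * d
  *-mono-≤-nonNeg {a} {b} {c} {d} 0≤c 0≤b a≤b c≤d = ≤-trans
    (*-monoʳ-≤-nonNeg c {{nonNegative 0≤c}} a≤b) (*-monoˡ-≤-nonNeg b {{nonNegative 0≤b}} c≤d)

  0≤* : ∀ {a b} → 0ℚ ≤ a → 0ℚ ≤ b → 0ℚ ≤ a * b
  0≤* {a} {b} 0≤a 0≤b = nonNegative⁻¹ (a * b) {{nonNeg*nonNeg⇒nonNeg a {{nonNegative 0≤a}} b {{nonNegative 0≤b}}}}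

  0<* : ∀ {a b} → 0ℚ < a → 0ℚ < b → 0ℚ < a * b
  0<* {a} {b} 0<a 0<b = positive⁻¹ (a * b) {{pos*pos⇒pos a {{positive 0<a}} b {{positive 0<b}}}}

  0≤^ : ∀ {a} k → 0ℚ ≤ a → 0ℚ ≤ a ^ k
  0≤^ zero    0≤a = nonNegative⁻¹ 1ℚ
  0≤^ (suc k) 0≤a = 0≤* 0≤a (0≤^ k 0≤a)

  0<^ : ∀ {a} k → 0ℚ < a → 0ℚ < a ^ k
  0<^ zero    0<a = positive⁻¹ 1ℚ
  0<^ (suc k) 0<a = 0<* 0<a (0<^ k 0<a)

  ^-mono-≤ : ∀ {a b} k → 0ℚ ≤ a → a ≤ b → a ^ k ≤ b ^ k
  ^-mono-≤ zero    0≤a a≤b = ≤-refl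
  ^-mono-≤ (suc k) 0≤a a≤b = *-mono-≤-nonNeg (0≤^ k 0≤a) (≤-trans 0≤a a≤b) a≤b (^-mono-≤ k 0≤a a≤b)

  ½^suc<1 : ∀ k → ½ ^ suc k < 1ℚ
  ½^suc<1 k = ≤-<-trans (*-monoˡ-≤-nonNeg ½ (½^≤1 k)) (*<* (ℤ.+<+ (ℕ.s≤s (ℕ.s≤s ℕ.z≤n))))
    where
    ½≤1 : ½ ≤ 1ℚ
    ½≤1 = *≤* (ℤ.+≤+ (ℕ.s≤s ℕ.z≤n))
    ½^≤1 : ∀ k → ½ ^ k ≤ 1ℚ
    ½^≤1 zero    = ≤-refl
    ½^≤1 (suc k) = *-mono-≤-nonNeg (0≤^ k (nonNegative⁻¹ ½)) (nonNegative⁻¹ 1ℚ) ½≤1 (½^≤1 k)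

  -- For `q = k / d` with `k ≥ 0`, compare exponents in `2 ^ (e * d) ≤ x ^ d ≤ a ^ d ≤ 2 ^ k`; a
  -- negative numerator would give `1 ≤ a ^ d < 1`. As `a` is any rational above `x`, this fits both
  -- logarithms in `log₂ (log₂ _)`.
  exponent-≥ : ∀ {x e a} q → 2 ℕ.^ e ℕ.≤ x → ι x ≤ a → a ^ (↧ₙ q) ≤ exp₂ (↥ q) → ι e ≤ q
  exponent-≥ {x} {e} {a} (mkℚ (+ k) d-1 c) 2^e≤x x≤a h rewrite ι≡mk e =
    *≤* (subst₂ ℤ._≤_ (ℤ.pos-* e (suc d-1)) (sym (ℤ.*-identityʳ (+ k))) (ℤ.+≤+ (ℕ.≮⇒≥ λ k<ed →
      ℕ.<⇒≱ (ℕ.^-monoʳ-< 2 ℕ.≤-refl k<ed) 2^ed≤2^k)))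
    where
    open ≤-Reasoning
    x^d≤2^k : x ℕ.^ suc d-1 ℕ.≤ 2 ℕ.^ k
    x^d≤2^k = ι-cancel-≤ (begin
      ι (x ℕ.^ suc d-1)  ≡⟨ ι-^ x (suc d-1) ⟩
      ι x ^ suc d-1      ≤⟨ ^-mono-≤ (suc d-1) (0≤ι x) x≤a ⟩
      a ^ suc d-1        ≤⟨ h ⟩
      exp₂ (+ k)         ≡⟨ ι-^ 2 k ⟨
      ι (2 ℕ.^ k)        ∎)
    2^ed≤2^k : 2 ℕ.^ (e ℕ.* suc d-1) ℕ.≤ 2 ℕ.^ k
    2^ed≤2^k = ℕ.≤-trans (ℕ.≤-reflexive (sym (ℕ.^-*-assoc 2 e (suc d-1))))
      (ℕ.≤-trans (ℕ.^-monoˡ-≤ (suc d-1) 2^e≤x) x^d≤2^k)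
  exponent-≥ {x} {e} {a} (mkℚ -[1+ k ] d-1 c) 2^e≤x x≤a h =
    contradiction (½^suc<1 k) λ lt → <-irrefl refl (<-≤-trans lt (begin
      1ℚ                 ≤⟨ ι-mono-≤ (ℕ.m^n>0 x {{ℕ.>-nonZero (ℕ.≤-trans (ℕ.m^n>0 2 e) 2^e≤x)}} (suc d-1)) ⟩
      ι (x ℕ.^ suc d-1)  ≡⟨ ι-^ x (suc d-1) ⟩
      ι x ^ suc d-1      ≤⟨ ^-mono-≤ (suc d-1) (0≤ι x) x≤a ⟩
      a ^ suc d-1        ≤⟨ h ⟩
      ½ ^ suc k          ∎))
    where
    open ≤-Reasoning

  exponent-≤ : ∀ {x e a} q → x ℕ.< 2 ℕ.^ e → 0ℚ ≤ a → a ≤ ι x → exp₂ (↥ q) ≤ a ^ (↧ₙ q) → q ≤ ι e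
  exponent-≤ {x} {e} {a} (mkℚ (+ k) d-1 c) x<2^e 0≤a a≤x h rewrite ι≡mk e =
    *≤* (subst₂ ℤ._≤_ (sym (ℤ.*-identityʳ (+ k))) (ℤ.pos-* e (suc d-1)) (ℤ.+≤+ (ℕ.≮⇒≥ λ ed<k →
      ℕ.<⇒≱ (ℕ.^-monoʳ-< 2 ℕ.≤-refl ed<k) 2^k≤2^ed)))
    where
    open ≤-Reasoning
    2^k≤x^d : 2 ℕ.^ k ℕ.≤ x ℕ.^ suc d-1
    2^k≤x^d = ι-cancel-≤ (begin
      ι (2 ℕ.^ k)        ≡⟨ ι-^ 2 k ⟩
      exp₂ (+ k)         ≤⟨ h ⟩
      a ^ suc d-1        ≤⟨ ^-mono-≤ (suc d-1) 0≤a a≤x ⟩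
      ι x ^ suc d-1      ≡⟨ ι-^ x (suc d-1) ⟨
      ι (x ℕ.^ suc d-1)  ∎)
    2^k≤2^ed : 2 ℕ.^ k ℕ.≤ 2 ℕ.^ (e ℕ.* suc d-1)
    2^k≤2^ed = ℕ.≤-trans 2^k≤x^d (ℕ.≤-trans (ℕ.^-monoˡ-≤ (suc d-1) (ℕ.<⇒≤ x<2^e)) (ℕ.≤-reflexive (ℕ.^-*-assoc 2 e (suc d-1))))
  exponent-≤ {e = e} (mkℚ -[1+ k ] d-1 c) _ _ _ _ rewrite ι≡mk e =
    *≤* (subst₂ ℤ._≤_ (sym (ℤ.*-identityʳ -[1+ k ])) (ℤ.pos-* e (suc d-1)) ℤ.-≤+)

  log₂-Lower-ι : ∀ {x a e} → 0ℚ < a → Lower x a → ι (2 ℕ.^ e) ≤ a → Lower (log₂ x) (ι e)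
  log₂-Lower-ι {x} {a} {e} 0<a a<x 2^e≤a rewrite ι≡mk e =
    a , 0<a , a<x , ≤-trans (≤-reflexive (sym (ι-^ 2 e))) (≤-trans 2^e≤a (≤-reflexive (sym (*-identityʳ a))))

  log₂-Upper-ι : ∀ {x a e} → Upper x a → a ≤ ι (2 ℕ.^ e) → Upper (log₂ x) (ι e)
  log₂-Upper-ι {x} {a} {e} x<a a≤2^e rewrite ι≡mk e =
    a , x<a , ≤-trans (≤-reflexive (*-identityʳ a)) (≤-trans a≤2^e (≤-reflexive (ι-^ 2 e)))

  0<ι-suc : ∀ n → 0ℚ < ι (suc n)
  0<ι-suc n = ι-mono-< {0} {suc n} (ℕ.s≤s ℕ.z≤n)

  1/ι : ℕ → ℚ
  1/ι n = 1/_ (ι (suc n)) {{pos⇒nonZero (ι (suc n)) {{positive (0<ι-suc n)}}}}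

  1/ι*ι : ∀ n → 1/ι n * ι (suc n) ≡ 1ℚ
  1/ι*ι n = *-inverseˡ (ι (suc n)) {{pos⇒nonZero (ι (suc n)) {{positive (0<ι-suc n)}}}}

  0<1/ι : ∀ n → 0ℚ < 1/ι n
  0<1/ι n = positive⁻¹ (1/ι n) {{1/pos⇒pos (ι (suc n)) {{positive (0<ι-suc n)}}}}

  rate : ℕ → ℝ
  rate n = log₂ (fromℕ n) ÷ᴿ log₂ (log₂ (fromℕ n))

  module _ {n l v : ℕ} (2^l≤n : 2 ℕ.^ l ℕ.≤ n) (n<2^suc-l : n ℕ.< 2 ℕ.^ suc l)
           (2^v≤l : 2 ℕ.^ v ℕ.≤ l) (l<2^suc-v : l ℕ.< 2 ℕ.^ suc v) where

    open ≤-Reasoning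

    -- The numerator is at most `suc l` and the denominator at least `v`; the inner `exponent-≥`,
    -- for `n`, feeds the outer one, for `log₂ n`.
    rate-≤ : ∀ {q} → 0ℚ < q → Lower (rate n) q → q * ι v ≤ ι (suc l)
    rate-≤ {q} 0<q (a , b , (a′ , 0<a′ , a′<n , h) , (b′ , (b″ , n<b″ , h″) , h′) , qb≤a) = begin
      q * ι v    ≤⟨ *-monoˡ-≤-nonNeg q {{nonNegative (<⇒≤ 0<q)}} (exponent-≥ {l} {v} b 2^v≤l
                     (exponent-≥ {n} {l} b′ 2^l≤n (<⇒≤ n<b″) h″) h′) ⟩
      q * b      ≤⟨ qb≤a ⟩
      a          ≤⟨ exponent-≤ {n} {suc l} a n<2^suc-l (<⇒≤ 0<a′) (<⇒≤ a′<n) h ⟩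
      ι (suc l)  ∎

    private
      regroup : ∀ a b c d → a * b * (c * d) ≡ (a * c) * (b * d)
      regroup = solve 4 (λ a b c d → a :* b :* (c :* d) := (a :* c) :* (b :* d)) refl

    rate^-≤ : ∀ t {q} → 0ℚ < q → Lower (rate n ^ᴿ t) q → q * ι v ^ t ≤ ι (suc l) ^ t
    rate^-≤ zero    {q} _ q<1 = ≤-trans (≤-reflexive (*-identityʳ q)) (<⇒≤ q<1)
    rate^-≤ (suc t) {q} 0<q (a , b , 0<a , La , 0<b , Lb , q≤ab) = begin
      q * (ι v * ι v ^ t)            ≤⟨ *-monoʳ-≤-nonNeg (ι v * ι v ^ t) {{nonNegative (0≤* (0≤ι v) (0≤^ t (0≤ι v)))}} q≤ab ⟩
      a * b * (ι v * ι v ^ t)        ≡⟨ regroup a b (ι v) (ι v ^ t) ⟩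
      a * ι v * (b * ι v ^ t)        ≤⟨ *-mono-≤-nonNeg (0≤* (<⇒≤ 0<b) (0≤^ t (0≤ι v))) (0≤ι (suc l)) (rate-≤ 0<a La) (rate^-≤ t 0<b Lb) ⟩
      ι (suc l) * ι (suc l) ^ t      ∎

    value-≤ : ∀ t {c C E q} → 0ℚ < c → c * ι C ≡ 1ℚ → 1 ℕ.≤ v → n ℕ.* suc l ℕ.^ t ℕ.≤ C ℕ.* (E ℕ.* v ℕ.^ t) →
              Lower (fromℚ c *ᴿ (fromℕ n *ᴿ rate n ^ᴿ t)) q → q < ι E
    value-≤ t {c} {C} {E} {q} 0<c cC≡1 1≤v nl≤ (a , b , 0<a , a<c , 0<b , (a′ , b′ , 0<a′ , a′<n , 0<b′ , Lb′ , b≤a′b′) , q≤ab) =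
      *-cancelʳ-<-nonNeg V {{nonNegative (<⇒≤ 0<V)}} (begin-strict
        q * V               ≤⟨ *-monoʳ-≤-nonNeg V {{nonNegative (<⇒≤ 0<V)}} q≤ab ⟩
        a * b * V           ≡⟨ *-assoc a b V ⟩
        -- The strict inequality that the cut of `ι E` demands comes from `a < c`.
        a * (b * V)         <⟨ *-monoˡ-<-pos (b * V) {{positive (0<* 0<b 0<V)}} a<c ⟩
        c * (b * V)         ≤⟨ *-monoˡ-≤-nonNeg c {{nonNegative (<⇒≤ 0<c)}} bV≤ ⟩
        c * (ι C * (ι E * V)) ≡⟨ *-assoc c (ι C) (ι E * V) ⟨
        c * ι C * (ι E * V) ≡⟨ cong (_* (ι E * V)) cC≡1 ⟩
        1ℚ * (ι E * V)      ≡⟨ *-identityˡ (ι E * V) ⟩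
        ι E * V             ∎)
      where
      V = ι v ^ t
      0<V : 0ℚ < V
      0<V = 0<^ t (ι-mono-< {0} {v} 1≤v)
      bV≤ : b * V ≤ ι C * (ι E * V)
      bV≤ = begin
        b * V                         ≤⟨ *-monoʳ-≤-nonNeg V {{nonNegative (<⇒≤ 0<V)}} b≤a′b′ ⟩
        a′ * b′ * V                   ≡⟨ *-assoc a′ b′ V ⟩
        a′ * (b′ * V)                 ≤⟨ *-mono-≤-nonNeg (0≤* (<⇒≤ 0<b′) (<⇒≤ 0<V)) (0≤ι n) (<⇒≤ a′<n) (rate^-≤ t 0<b′ Lb′) ⟩
        ι n * ι (suc l) ^ t           ≡⟨ cong (ι n *_) (ι-^ (suc l) t) ⟨
        ι n * ι (suc l ℕ.^ t)         ≡⟨ ι-* n (suc l ℕ.^ t) ⟨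
        ι (n ℕ.* suc l ℕ.^ t)         ≤⟨ ι-mono-≤ nl≤ ⟩
        ι (C ℕ.* (E ℕ.* v ℕ.^ t))     ≡⟨ ι-* C (E ℕ.* v ℕ.^ t) ⟩
        ι C * ι (E ℕ.* v ℕ.^ t)       ≡⟨ cong (ι C *_) (trans (ι-* E (v ℕ.^ t)) (cong (ι E *_) (ι-^ v t))) ⟩
        ι C * (ι E * V)               ∎

    module _ {l′ : ℕ} (l≡ : l ≡ suc l′) (1≤l′ : 1 ℕ.≤ l′) where

      -- A rational in the lower cut of the rate. Lower cuts are open, so `l′ = l - 1` stands in for
      -- `l`, which is not below `log n` when `n = 2 ^ l`; likewise `suc v` lies above `log log n`.
      κ : ℚ
      κ = ι l′ * 1/ι v

      κ*suc-v≡l′ : κ * ι (suc v) ≡ ι l′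
      κ*suc-v≡l′ = trans (*-assoc (ι l′) _ _) (trans (cong (ι l′ *_) (1/ι*ι v)) (*-identityʳ (ι l′)))

      0<κ : 0ℚ < κ
      0<κ = *-cancelʳ-<-nonNeg (ι (suc v)) {{nonNegative (<⇒≤ (0<ι-suc v))}}
        (subst₂ _<_ (sym (*-zeroˡ (ι (suc v)))) (sym κ*suc-v≡l′) (ι-mono-< 1≤l′))

      Lower-rate-κ : Lower (rate n) κ
      Lower-rate-κ = ι l′ , ι (suc v) ,
        log₂-Lower-ι {fromℕ n} {a = ι (2 ℕ.^ l′)} {e = l′} (ι-mono-< (ℕ.m^n>0 2 l′))
          (ι-mono-< (ℕ.<-≤-trans (ℕ.^-monoʳ-< 2 ℕ.≤-refl (ℕ.≤-reflexive (sym l≡))) 2^l≤n)) ≤-refl ,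
        log₂-Upper-ι {log₂ (fromℕ n)} {a = ι (suc l)} {e = suc v}
          (log₂-Upper-ι {fromℕ n} {a = ι (2 ℕ.^ suc l)} {e = suc l} (ι-mono-< n<2^suc-l) ≤-refl)
          (ι-mono-≤ l<2^suc-v) ,
        ≤-reflexive κ*suc-v≡l′

      -- The factor ½ makes room for the strict inequality q < 1 of the zeroth power.
      ½κ^ : ℕ → ℚ
      ½κ^ zero    = ½
      ½κ^ (suc t) = κ * ½κ^ t

      0<½κ^ : ∀ t → 0ℚ < ½κ^ t
      0<½κ^ zero    = positive⁻¹ ½
      0<½κ^ (suc t) = 0<* 0<κ (0<½κ^ t)

      Lower-rate^ : ∀ t → Lower (rate n ^ᴿ t) (½κ^ t)
      Lower-rate^ zero    = ½^suc<1 0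
      Lower-rate^ (suc t) = κ , ½κ^ t , 0<κ , Lower-rate-κ , 0<½κ^ t , Lower-rate^ t , ≤-refl

      ½κ^-value : ∀ t → ½κ^ t * ι (suc v) ^ t ≡ ½ * ι l′ ^ t
      ½κ^-value zero    = refl
      ½κ^-value (suc t) = trans (regroup κ (½κ^ t) (ι (suc v)) (ι (suc v) ^ t))
        (trans (cong₂ _*_ κ*suc-v≡l′ (½κ^-value t)) (rotate (ι l′) ½ (ι l′ ^ t)))
        where
        rotate : ∀ a b c → a * (b * c) ≡ b * (a * c)
        rotate = solve 3 (λ a b c → a :* (b :* c) := b :* (a :* c)) refl

      -- The witnesses must lie strictly below the factors: `suc C` below `suc (suc C)`, `½ * ι n`
      -- below `ι n`, and `½κ^ t` below the power of the rate. The two halves are compensated by the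
      -- 4.
      value-≥ : ∀ t {C E q} → 4 ℕ.* (E ℕ.* suc v ℕ.^ t) ℕ.≤ suc C ℕ.* (n ℕ.* l′ ℕ.^ t) → q < ι E →
                Lower (fromℚ (ι (suc (suc C))) *ᴿ (fromℕ n *ᴿ rate n ^ᴿ t)) q
      value-≥ t {C} {E} {q} Ev≤ q<E =
        ι (suc C) , ½ * ι n * ½κ^ t , ι-mono-< {0} {suc C} (ℕ.s≤s ℕ.z≤n) , ι-mono-< {suc C} {suc (suc C)} ℕ.≤-refl ,
        0<* (0<* (positive⁻¹ ½) 0<n) (0<½κ^ t) ,
        (½ * ι n , ½κ^ t , 0<* (positive⁻¹ ½) 0<n , half< , 0<½κ^ t , Lower-rate^ t , ≤-refl) ,
        ≤-trans (<⇒≤ q<E) (*-cancelʳ-≤-pos V {{positive 0<V}} (*-cancelˡ-≤-pos (ι 4) {{positive (ι-mono-< {0} {4} (ℕ.s≤s ℕ.z≤n))}} (begin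
          ι 4 * (ι E * V)                                ≡⟨ cong (λ x → ι 4 * (ι E * x)) (ι-^ (suc v) t) ⟨
          ι 4 * (ι E * ι (suc v ℕ.^ t))                  ≡⟨ cong (ι 4 *_) (ι-* E (suc v ℕ.^ t)) ⟨
          ι 4 * ι (E ℕ.* suc v ℕ.^ t)                    ≡⟨ ι-* 4 (E ℕ.* suc v ℕ.^ t) ⟨
          ι (4 ℕ.* (E ℕ.* suc v ℕ.^ t))                  ≤⟨ ι-mono-≤ Ev≤ ⟩
          ι (suc C ℕ.* (n ℕ.* l′ ℕ.^ t))                 ≡⟨ ι-* (suc C) (n ℕ.* l′ ℕ.^ t) ⟩
          ι (suc C) * ι (n ℕ.* l′ ℕ.^ t)                 ≡⟨ cong (ι (suc C) *_) (trans (ι-* n (l′ ℕ.^ t)) (cong (ι n *_) (ι-^ l′ t))) ⟩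
          ι (suc C) * (ι n * ι l′ ^ t)                   ≡⟨ halves (ι (suc C)) (ι n) (ι l′ ^ t) ⟩
          ι 4 * (ι (suc C) * (½ * ι n * (½ * ι l′ ^ t))) ≡⟨ cong (λ x → ι 4 * (ι (suc C) * (½ * ι n * x))) (½κ^-value t) ⟨
          ι 4 * (ι (suc C) * (½ * ι n * (½κ^ t * V)))    ≡⟨ cong (ι 4 *_) (assoc (ι (suc C)) (½ * ι n) (½κ^ t) V) ⟩
          ι 4 * (ι (suc C) * (½ * ι n * ½κ^ t) * V)      ∎)))
        where
        V = ι (suc v) ^ t
        0<V : 0ℚ < V
        0<V = 0<^ t (0<ι-suc v)
        0<n : 0ℚ < ι n
        0<n = ι-mono-< (ℕ.<-≤-trans (ℕ.m^n>0 2 l) 2^l≤n)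
        half< : ½ * ι n < ι n
        half< = <-≤-trans (*-monoˡ-<-pos (ι n) {{positive 0<n}} (½^suc<1 0)) (≤-reflexive (*-identityˡ (ι n)))
        halves : ∀ c n x → c * (n * x) ≡ ι 4 * (c * (½ * n * (½ * x)))
        halves = solve 3 (λ c n x → c :* (n :* x) := con (ι 4) :* (c :* (con ½ :* n :* (con ½ :* x)))) refl
        assoc : ∀ c a b x → c * (a * (b * x)) ≡ c * (a * b) * x
        assoc = solve 4 (λ c a b x → c :* (a :* (b :* x)) := c :* (a :* b) :* x) refl

-- Rounded logarithms and the asymptotic bounds

open Combinatorics
open Cuts
open import Data.Nat.Base using (ℕ; zero; suc; _+_; _∸_; _*_; _^_; _≤_; _<_; z≤n; s≤s; s≤s⁻¹; pred; >-nonZero)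
open import Data.Nat.Properties
open import Data.Nat.Tactic.RingSolver using (solve-∀)
open import Data.Fin.Base using (toℕ)
open import Data.Product.Base
open import Relation.Binary.PropositionalEquality

log-bracket : ∀ {n} → 1 ≤ n → ∃ λ l → 2 ^ l ≤ n × n < 2 ^ suc l
log-bracket {n} 1≤n with l , lo , hi ← bracket (2 ^_) n 1≤n (n<2^n n) = toℕ l , lo , hi

2^-cancel-< : ∀ {a b} → 2 ^ a < 2 ^ b → a < b
2^-cancel-< lt = ≰⇒> λ b≤a → <⇒≱ lt (^-monoʳ-≤ 2 b≤a)

-- The induction starts with the product of `K ≤ 2 ^ K` and `suc (K + K) ≤ 2 ^ suc K`; each step
-- adds `K` on the left and doubles the right.
linear≤2^ : ∀ K d → K * (d + suc (K + K)) ≤ 2 ^ (d + suc (K + K))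
linear≤2^ K zero = begin
  K * suc (K + K)           ≤⟨ *-mono-≤ (<⇒≤ (n<2^n K)) suc[K+K]≤ ⟩
  2 ^ K * 2 ^ suc K         ≡⟨ ^-distribˡ-+-* 2 K (suc K) ⟨
  2 ^ (K + suc K)           ≡⟨ cong (2 ^_) (+-suc K K) ⟩
  2 ^ suc (K + K)           ∎
  where
  open ≤-Reasoning
  suc[K+K]≤ : suc (K + K) ≤ 2 ^ suc K
  suc[K+K]≤ = begin
    suc (K + K)       ≤⟨ +-monoʳ-≤ (suc K) (n≤1+n K) ⟩
    suc K + suc K     ≤⟨ +-mono-≤ (n<2^n K) (n<2^n K) ⟩
    2 ^ K + 2 ^ K     ≡⟨ cong (2 ^ K +_) (+-identityʳ (2 ^ K)) ⟨
    2 ^ suc K         ∎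
linear≤2^ K (suc d) = begin
  K * suc (d + s)             ≡⟨ *-suc K (d + s) ⟩
  K + K * (d + s)             ≤⟨ +-mono-≤ K≤ (linear≤2^ K d) ⟩
  2 ^ (d + s) + 2 ^ (d + s)   ≡⟨ cong (2 ^ (d + s) +_) (+-identityʳ (2 ^ (d + s))) ⟨
  2 ^ suc (d + s)             ∎
  where
  open ≤-Reasoning
  s = suc (K + K)
  K≤ : K ≤ 2 ^ (d + s)
  K≤ = ≤-trans (<⇒≤ (n<2^n K)) (^-monoʳ-≤ 2 (≤-trans (m≤m+n K K) (≤-trans (n≤1+n _) (m≤n+m s d))))

module _ (t K : ℕ) (1≤t : 1 ≤ t) where

  private
    -- `V ≤ v` ensures `2 * t ≤ v` and, by `linear≤2^`, `K * v ≤ 2 ^ v ≤ l`; hence the threshold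
    -- `2 ^ 2 ^ V` for `n`.
    V = 2 * t + suc (K + K)

  record Logs (n : ℕ) : Set where
    field
      l l′ v  : ℕ
      2^l≤n   : 2 ^ l ≤ n
      n<      : n < 2 ^ suc l
      2^v≤l   : 2 ^ v ≤ l
      l<      : l < 2 ^ suc v
      2t≤v    : 2 * t ≤ v
      Kv≤l    : K * v ≤ l
      l≡      : l ≡ suc l′

  logs : ∀ {n} → 2 ^ 2 ^ V ≤ n → Logs n
  logs {n} N≤n
    with l , 2^l≤n , n< ← log-bracket (≤-trans (m^n>0 2 (2 ^ V)) N≤n)
    with 2^V≤l ← s≤s⁻¹ (2^-cancel-< {2 ^ V} {suc l} (≤-<-trans N≤n n<))
    with 1≤l ← ≤-trans (m^n>0 2 V) 2^V≤l
    with v , 2^v≤l , l< ← log-bracket 1≤l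
    with V≤v ← s≤s⁻¹ (2^-cancel-< {V} {suc v} (≤-<-trans 2^V≤l l<)) = record
      { l = l ; l′ = pred l ; v = v ; 2^l≤n = 2^l≤n ; n< = n< ; 2^v≤l = 2^v≤l ; l< = l<
      ; 2t≤v = ≤-trans (m≤m+n (2 * t) _) V≤v
      ; Kv≤l = ≤-trans Kv≤2^v 2^v≤l
      ; l≡ = sym (suc-pred l {{>-nonZero 1≤l}}) }
    where
    Kv≤2^v : K * v ≤ 2 ^ v
    Kv≤2^v = subst (λ x → K * x ≤ 2 ^ x) (m∸n+n≡m (≤-trans (m≤n+m (suc (K + K)) (2 * t)) V≤v)) (linear≤2^ K (v ∸ suc (K + K)))

  private
    suc≤2* : ∀ {x} → 1 ≤ x → suc x ≤ 2 * x
    suc≤2* {x} 1≤x = ≤-trans (+-monoˡ-≤ x 1≤x) (≤-reflexive (cong (x +_) (sym (+-identityʳ x))))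

    power-2* : ∀ {x} y → x ≤ 2 * y → x ^ t ≤ 2 ^ t * y ^ t
    power-2* y x≤ = ≤-trans (^-monoˡ-≤ t x≤) (≤-reflexive (^-distribʳ-* t 2 y))

  module _ {n : ℕ} (L : Logs n) where
    open Logs L

    1≤v : 1 ≤ v
    1≤v = ≤-trans 1≤t (≤-trans (m≤m+n t (t + 0)) 2t≤v)

    1≤l : 1 ≤ l
    1≤l = ≤-trans (m^n>0 2 v) 2^v≤l

    1≤l′ : 1 ≤ l′
    1≤l′ = s≤s⁻¹ (≤-trans (≤-trans (^-monoʳ-≤ 2 1≤v) 2^v≤l) (≤-reflexive l≡))

  LowerBound UpperBound : ℕ → Set
  LowerBound C = ∀ {n l v} → 2 ^ l ≤ n → l < 2 ^ suc v → 1 ≤ v → K * v ≤ l →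
                 n * l ^ t ≤ C * (Ex (alternating t) n * v ^ t)
  UpperBound C = ∀ {n l v} → n < 2 ^ suc l → 2 ^ v ≤ l → 2 * t ≤ v →
                 Ex (alternating t) n * v ^ t ≤ C * (n * l ^ t)

  -- `value-≤` asks for `suc l` in place of `l`, at the price of `2 ^ t`. The outer `suc` makes the
  -- constant positive, to be inverted by `1/ι`.
  lower-logs : ∀ {n} D → LowerBound D → (L : Logs n) → let open Logs L in
               n * suc l ^ t ≤ suc (2 ^ t * D) * (Ex (alternating t) n * v ^ t)
  lower-logs {n} D bound L = begin
    n * suc l ^ t                  ≤⟨ *-monoʳ-≤ n (power-2* l (suc≤2* (1≤l L))) ⟩
    n * (2 ^ t * l ^ t)            ≡⟨ rotate n (2 ^ t) (l ^ t) ⟩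
    2 ^ t * (n * l ^ t)            ≤⟨ *-monoʳ-≤ (2 ^ t) (bound 2^l≤n l< (1≤v L) Kv≤l) ⟩
    2 ^ t * (D * (E * v ^ t))      ≡⟨ *-assoc (2 ^ t) D (E * v ^ t) ⟨
    2 ^ t * D * (E * v ^ t)        ≤⟨ m≤n+m _ (E * v ^ t) ⟩
    suc (2 ^ t * D) * (E * v ^ t)  ∎
    where
    open ≤-Reasoning
    open Logs L
    E = Ex (alternating t) n
    rotate : ∀ a b c → a * (b * c) ≡ b * (a * c)
    rotate = solve-∀

  -- `value-≥` asks for `suc v` in place of `v` and `l′` in place of `l`, each at the price of
  -- `2 ^ t`, and for the factor 4.
  upper-logs : ∀ {n} D → UpperBound D → (L : Logs n) → let open Logs L in
               4 * (Ex (alternating t) n * suc v ^ t) ≤ suc (4 * (2 ^ t * (2 ^ t * D))) * (n * l′ ^ t)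
  upper-logs {n} D bound L = begin
    4 * (E * suc v ^ t)                         ≤⟨ *-monoʳ-≤ 4 (*-monoʳ-≤ E (power-2* v (suc≤2* (1≤v L)))) ⟩
    4 * (E * (2 ^ t * v ^ t))                   ≡⟨ regroup E (2 ^ t) (v ^ t) ⟩
    4 * (2 ^ t * (E * v ^ t))                   ≤⟨ *-monoʳ-≤ 4 (*-monoʳ-≤ (2 ^ t) (bound n< 2^v≤l 2t≤v)) ⟩
    4 * (2 ^ t * (D * (n * l ^ t)))             ≤⟨ *-monoʳ-≤ 4 (*-monoʳ-≤ (2 ^ t) (*-monoʳ-≤ D (*-monoʳ-≤ n
                                                     (power-2* l′ (≤-trans (≤-reflexive l≡) (suc≤2* (1≤l′ L))))))) ⟩
    4 * (2 ^ t * (D * (n * (2 ^ t * l′ ^ t))))  ≡⟨ regroup′ (2 ^ t) D n (l′ ^ t) ⟩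
    4 * (2 ^ t * (2 ^ t * D)) * (n * l′ ^ t)    ≤⟨ m≤n+m _ (n * l′ ^ t) ⟩
    suc (4 * (2 ^ t * (2 ^ t * D))) * (n * l′ ^ t) ∎
    where
    open ≤-Reasoning
    open Logs L
    E = Ex (alternating t) n
    regroup : ∀ e a b → 4 * (e * (a * b)) ≡ 4 * (a * (e * b))
    regroup = solve-∀
    regroup′ : ∀ a d n x → 4 * (a * (d * (n * (a * x)))) ≡ 4 * (a * (a * d)) * (n * x)
    regroup′ = solve-∀

  cuts : ∀ {n} C₁ C₂ (L : Logs n) → let open Logs L in
         n * suc l ^ t ≤ suc C₁ * (Ex (alternating t) n * v ^ t) →
         4 * (Ex (alternating t) n * suc v ^ t) ≤ suc C₂ * (n * l′ ^ t) →
         (fromℚ (1/ι C₁) *ᴿ (fromℕ n *ᴿ rate n ^ᴿ t) ≤ᴿ fromℕ (Ex (alternating t) n)) ×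
         (fromℕ (Ex (alternating t) n) ≤ᴿ fromℚ (ι (suc (suc C₂))) *ᴿ (fromℕ n *ᴿ rate n ^ᴿ t))
  cuts {n} C₁ C₂ L lower upper =
    (λ q → value-≤ 2^l≤n n< 2^v≤l l< t {1/ι C₁} {suc C₁} {E} (0<1/ι C₁) (1/ι*ι C₁) (1≤v L) lower) ,
    (λ q → value-≥ 2^l≤n n< 2^v≤l l< l≡ (1≤l′ L) t {C₂} {E} upper)
    where
    open Logs L
    E = Ex (alternating t) n

  bounds⇒Θ : ∃ LowerBound → ∃ UpperBound → (λ n → fromℕ (Ex (alternating t) n)) =Θ (λ n → fromℕ n *ᴿ rate n ^ᴿ t)
  bounds⇒Θ (D₁ , lower) (D₂ , upper) =
    1/ι C₁ , ι (suc (suc C₂)) , 0<1/ι C₁ , ι-mono-< {0} {suc (suc C₂)} (s≤s z≤n) , 2 ^ 2 ^ V , λ n N≤n →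
    cuts C₁ C₂ (logs N≤n) (lower-logs D₁ lower (logs N≤n)) (upper-logs D₂ upper (logs N≤n))
    where
    C₁ = 2 ^ t * D₁
    C₂ = 4 * (2 ^ t * (2 ^ t * D₂))

theorem1p3 : ∀ (t : ℕ) → 2 ≤ t →
    (λ n → fromℕ (Ex (alternating t) n))
    =Θ (λ n → fromℕ n *ᴿ (log₂ (fromℕ n) ÷ᴿ log₂ (log₂ (fromℕ n))) ^ᴿ t)
theorem1p3 (suc (suc s)) (s≤s (s≤s _)) =
  -- `Ex-lower-log` is indexed by `t - 1` and `Ex-upper` by `t - 2`; `(4 + s) * (4 + s)` is the `K`
  -- of the former for `T = suc s`.
  bounds⇒Θ (suc (suc s)) ((4 + s) * (4 + s)) (s≤s z≤n) (Ex-lower-log (suc s)) (Ex-upper s)
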